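{- Let $H$ be a fixed graph with binary chromatic number $\chi_B(H)=k+1$. Then, as $n\to\infty$, $$\mathrm{Dist}(n,\mathrm{Forb}(n,H))>(1-o(1))\frac{n^2}{4k}.$$
   Context: An edge-operation on a graph is the deletion of an existing edge or the addition of a non-existing edge. For graphs $G,G'$ on the same number of vertices, $\mathrm{Dist}(G,G')=\min\{|E(G)\,\Delta\, E(G'')| : G''\cong G',\ V(G'')=V(G)\}$, i.e. the minimum number of edge-operations needed to transform $G$ into a graph isomorphic to $G'$. For a family $\mathcal H$ of $n$-vertex graphs and an $n$-vertex graph $G$, $\mathrm{Dist}(G,\mathcal H)=\min_{H'\in\mathcal H}\mathrm{Dist}(G,H')$, and $\mathrm{Dist}(n,\mathcal H)=\max\{\mathrm{Dist}(G,\mathcal H): |V(G)|=n\}$. $\mathrm{Forb}(n,H)$ denotes the set of all graphs on $n$ vertices containing no induced subgraph isomorphic to $H$. A clique is a vertex set inducing a complete graph, a coclique is a vertex set inducing an edgeless graph. The binary chromatic number $\chi_B(G)$ of a graph $G$ is the least integer $k+1$ such that for every $c\in\{0,1,\dots,k+1\}$ there exists a partition of $V(G)$ into $c$ cliques and $k+1-c$ cocliques (parts may be empty). -}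

module Defs where

open import Data.Nat using (ℕ; zero; suc; _+_; _*_; _∸_; _≤_; _<_; _<ᵇ_)
open import Data.Bool using (Bool; true; false; if_then_else_; _∧_; _xor_)
open import Data.Fin using (Fin; toℕ)
open import Data.Fin.Permutation using (Permutation′; _⟨$⟩ʳ_)
open import Data.List using (List; map; allFin)
open import Data.Nat.ListAction using (sum)
open import Data.Sum using (_⊎_; inj₁; inj₂)
open import Data.Product using (Σ; ∃; _×_)
open import Function.Definitions using (Injective)
open import Relation.Binary.PropositionalEquality using (_≡_)
open import Relation.Nullary using (¬_)

record Graph (n : ℕ) : Set where
  field
    adj    : Fin n → Fin n → Bool
    sym    : ∀ i j → adj i j ≡ adj j i
    irrefl : ∀ i → adj i i ≡ false
open Graph public

ContainsInduced : ∀ {n m} → Graph n → Graph m → Set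
ContainsInduced {n} {m} G H =
  Σ (Fin m → Fin n) λ f → Injective _≡_ _≡_ f × (∀ i j → adj H i j ≡ adj G (f i) (f j))

InForb : ∀ {n m} → Graph m → Graph n → Set
InForb H G = ¬ ContainsInduced G H

relabel : ∀ {n} → Permutation′ n → Graph n → Graph n
relabel σ G = record
  { adj = λ i j → adj G (σ ⟨$⟩ʳ i) (σ ⟨$⟩ʳ j)
  ; sym = λ i j → sym G (σ ⟨$⟩ʳ i) (σ ⟨$⟩ʳ j)
  ; irrefl = λ i → irrefl G (σ ⟨$⟩ʳ i) }

symDiff : ∀ {n} → Graph n → Graph n → ℕ
symDiff {n} G G' = sum (map (λ i → sum (map (λ j →
    if (toℕ i <ᵇ toℕ j) ∧ (adj G i j xor adj G' i j) then 1 else 0)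
  (allFin n))) (allFin n))

-- A partition of V(H) into c cliques and d cocliques (parts may be empty).
record CliqueCocliquePartition {m} (H : Graph m) (c d : ℕ) : Set where
  field
    part     : Fin m → Fin c ⊎ Fin d
    clique   : ∀ i j (p : Fin c) → part i ≡ inj₁ p → part j ≡ inj₁ p → ¬ i ≡ j → adj H i j ≡ true
    coclique : ∀ i j (p : Fin d) → part i ≡ inj₂ p → part j ≡ inj₂ p → adj H i j ≡ false

BinaryColourable : ∀ {m} → Graph m → ℕ → Set
BinaryColourable H t = ∀ c → c ≤ t → CliqueCocliquePartition H c (t ∸ c)

ChiB≡ : ∀ {m} → Graph m → ℕ → Set
ChiB≡ H t = BinaryColourable H t × (∀ s → 1 ≤ s → s < t → ¬ BinaryColourable H s)

{-# OPTIONS --safe #-}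
module Submission where

-- The host graph has vertices (p , q) with p ∈ [ℓ] and q ⊆ [ℓ], blown up evenly to n vertices; (p , q) and (p′ , q′)
-- are adjacent iff exactly one of p′ ∈ q, p ∈ q′ holds.  Over vertices with distinct first labels, the fibre of any
-- fixed p realises all adjacency patterns equally often.
--
-- Let G′ differ from the host graph in too few pairs. Deleting vertices of large error degree leaves a large set in
-- which every error degree is small, and there one embeds arbitrary multipartite patterns into G′, one part at a
-- time. Suppose r ≤ k parts are embedded, every vertex being blown up to a class of N clones. A trie argument gives
-- polynomially many exceptional vectors per class such that, for every vector which G′ induces on these classes
-- from a fibre, the set P of classes in which it is not exceptional has a transversal shattered by that fibre. A
-- random vector is at distance about N/2 from polynomially many vectors, so every class outside P costs about N/2
-- errors; since the errors, averaged over each part and summed over the parts, stay below N/2 by a constant factor,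
-- P has positive density in each part. The embedded pattern is chosen so that all such P contain the pattern we
-- want, which the shattering fibres, chosen by pigeonhole, extend in every possible way.
--
-- Ramsey's theorem makes every new part a clique or a coclique of G′.  After k + 1 parts, the assumption that H splits
-- into c cliques and k + 1 - c cocliques, for the number c of cliques that occurred, exhibits H as a pattern.

open import Defs
open import Data.Bool using (Bool; true; false; if_then_else_; not; _∧_; _xor_)
open import Data.Bool.Properties using (xor-assoc; xor-comm; xor-same; ¬-not) renaming (_≟_ to _≟ᵇ_)
open import Data.Fin using (Fin; zero; suc; toℕ; fromℕ<; combine; remQuot; quotient; remainder; finToFun; funToFin; inject≤; splitAt; _↑ˡ_; _↑ʳ_; _≟_)
open import Data.Fin.Permutation using (Permutation′; _⟨$⟩ʳ_; _⟨$⟩ˡ_; inverseˡ)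
open import Data.Fin.Properties using (any?; all?; ¬∀⟶∃¬; pigeonhole; suc-injective; combine-injective; remQuot-combine; finToFun-funToFin; splitAt-↑ˡ; splitAt-↑ʳ; toℕ-injective; toℕ<n)
open import Data.List using (List; []; _∷_; _++_; length; filter; lookup; map; concat; tabulate; allFin)
open import Data.List.Membership.Propositional using (_∈_)
open import Data.List.Membership.Propositional.Properties using (∈-filter⁺; ∈-filter⁻; ∈-lookup; ∈-allFin)
open import Data.List.Properties using (length-map; length-++; length-tabulate)
open import Data.List.Relation.Unary.All using (All; []; _∷_)
import Data.List.Relation.Unary.All as All
import Data.List.Relation.Unary.All.Properties as All
open import Data.List.Relation.Unary.AllPairs using (AllPairs; []; _∷_)
import Data.List.Relation.Unary.AllPairs as AP
import Data.List.Relation.Unary.AllPairs.Properties as AllPairs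
open import Data.List.Relation.Unary.Any using (Any; here; there)
import Data.List.Relation.Unary.Any as Any
import Data.List.Relation.Unary.Any.Properties as Any
open import Data.List.Relation.Unary.Unique.Propositional using (Unique)
import Data.List.Relation.Unary.Unique.Propositional.Properties as Unique
import Data.Nat.ListAction as ListAction
open import Data.Nat using (ℕ; zero; suc; _+_; _*_; _∸_; _^_; _≤_; _<_; _>_; _<ᵇ_; _⊔_; z≤n; s≤s; NonZero; _/_; _%_; _≤?_; _<?_; >-nonZero)
open import Data.Nat.DivMod using (m≡m%n+[m/n]*n; m%n<n)
open import Data.Nat.Properties hiding (_≟_; suc-injective)
import Data.Nat.Properties as ℕ
open import Data.Nat.Solver using (module +-*-Solver)
open import Data.Product using (Σ; ∃; ∃₂; _×_; _,_; proj₁; proj₂)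
open import Data.Sum using (_⊎_; inj₁; inj₂; [_,_]′)
open import Data.Sum.Properties using (inj₁-injective; inj₂-injective)
open import Data.Vec.Functional using (updateAt)
open import Data.Vec.Functional.Properties using (updateAt-updates; updateAt-minimal)
open import Function using (_∘_; id; const; case_of_)
open import Relation.Binary.PropositionalEquality using (_≡_; _≢_; _≗_; refl; trans; cong; cong₂; subst; subst₂; module ≡-Reasoning)
import Relation.Binary.PropositionalEquality as ≡
open import Relation.Nullary using (¬_; Dec; yes; no; does; contradiction)
open import Relation.Binary.Definitions using (Tri; tri<; tri≈; tri>)
open import Relation.Nullary.Decidable using (_×-dec_; dec-true; dec-false)
open +-*-Solver using (solve; _:=_; _:+_; _:*_; con)

𝟙 : Bool → ℕ
𝟙 b = if b then 1 else 0

𝟙≤1 : ∀ b → 𝟙 b ≤ 1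
𝟙≤1 true  = s≤s z≤n
𝟙≤1 false = z≤n

-- Finite sums

-- Abstract, so that unification treats sum as rigid.
abstract
  sum : ∀ {n} → (Fin n → ℕ) → ℕ
  sum {zero}  f = 0
  sum {suc n} f = f zero + sum (f ∘ suc)

  sum-empty : (f : Fin 0 → ℕ) → sum f ≡ 0
  sum-empty f = refl

  sum-suc : ∀ {n} (f : Fin (suc n) → ℕ) → sum f ≡ f zero + sum (f ∘ suc)
  sum-suc f = refl

  sum-mono : ∀ {n} {f g : Fin n → ℕ} → (∀ i → f i ≤ g i) → sum f ≤ sum g
  sum-mono {zero}  f≤g = z≤n
  sum-mono {suc n} f≤g = +-mono-≤ (f≤g zero) (sum-mono (f≤g ∘ suc))

  sum-cong : ∀ {n} {f g : Fin n → ℕ} → (∀ i → f i ≡ g i) → sum f ≡ sum g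
  sum-cong {zero}  f≗g = refl
  sum-cong {suc n} f≗g = cong₂ _+_ (f≗g zero) (sum-cong (f≗g ∘ suc))

  sum-+ : ∀ {n} (f g : Fin n → ℕ) → sum (λ i → f i + g i) ≡ sum f + sum g
  sum-+ {zero}  f g = refl
  sum-+ {suc n} f g = trans (cong (f zero + g zero +_) (sum-+ (f ∘ suc) (g ∘ suc)))
    (solve 4 (λ a b c d → a :+ b :+ (c :+ d) := a :+ c :+ (b :+ d)) refl (f zero) (g zero) (sum (f ∘ suc)) (sum (g ∘ suc)))

  sum-*ˡ : ∀ {n} x (f : Fin n → ℕ) → x * sum f ≡ sum (λ i → x * f i)
  sum-*ˡ {zero}  x f = *-zeroʳ x
  sum-*ˡ {suc n} x f = trans (*-distribˡ-+ x (f zero) (sum (f ∘ suc))) (cong (x * f zero +_) (sum-*ˡ x (f ∘ suc)))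

  sum-const : ∀ n x → sum {n} (λ _ → x) ≡ n * x
  sum-const zero    x = refl
  sum-const (suc n) x = cong (x +_) (sum-const n x)

  term≤sum : ∀ {n} (f : Fin n → ℕ) i → f i ≤ sum f
  term≤sum f zero    = m≤m+n _ _
  term≤sum f (suc i) = ≤-trans (term≤sum (f ∘ suc) i) (m≤n+m _ _)

  sum-join : ∀ m n (f : Fin (m + n) → ℕ) → sum f ≡ sum (λ i → f (i ↑ˡ n)) + sum (λ i → f (m ↑ʳ i))
  sum-join zero    n f = refl
  sum-join (suc m) n f = trans (cong (f zero +_) (sum-join m n (f ∘ suc))) (≡.sym (+-assoc (f zero) _ _))

  sum-combine : ∀ m n (f : Fin (m * n) → ℕ) → sum f ≡ sum {m} (λ i → sum {n} (λ j → f (combine i j)))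
  sum-combine zero    n f = refl
  sum-combine (suc m) n f =
    trans (sum-join n (m * n) f) (cong (sum (λ j → f (j ↑ˡ (m * n))) +_) (sum-combine m n (f ∘ (n ↑ʳ_))))

  sum-inject≤ : ∀ {m n} (m≤n : m ≤ n) (f : Fin n → ℕ) → sum (λ i → f (inject≤ i m≤n)) ≤ sum f
  sum-inject≤ {zero}  {n}     m≤n       f = z≤n
  sum-inject≤ {suc m} {suc n} (s≤s m≤n) f = +-monoʳ-≤ (f zero) (sum-inject≤ m≤n (f ∘ suc))

  sum-zero : ∀ n → sum {n} (λ _ → 0) ≡ 0
  sum-zero n = trans (sum-const n 0) (*-zeroʳ n)

  sum-comm : ∀ {m n} (f : Fin m → Fin n → ℕ) → sum (λ i → sum (λ j → f i j)) ≡ sum (λ j → sum (λ i → f i j))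
  sum-comm {zero}  {n} f = ≡.sym (sum-zero n)
  sum-comm {suc m} {n} f = trans (cong (sum (f zero) +_) (sum-comm (f ∘ suc))) (≡.sym (sum-+ (f zero) _))

  sum-δ : ∀ {n} (v : Fin n) (f : Fin n → ℕ) → sum (λ i → 𝟙 (does (i ≟ v)) * f i) ≡ f v
  sum-δ {suc n} zero    f = trans (cong₂ _+_ (+-identityʳ (f zero)) (sum-zero n)) (+-identityʳ (f zero))
  sum-δ {suc n} (suc v) f = sum-δ v (f ∘ suc)

  large-term : ∀ {n} x (f : Fin n → ℕ) → n * x < sum f → ∃ λ i → x < f i
  large-term {zero}  x f ()
  large-term {suc n} x f lt with x <? f zero
  ... | yes x<f₀ = zero , x<f₀
  ... | no  x≮f₀ with large-term x (f ∘ suc)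
    (+-cancelˡ-< x _ _ (<-≤-trans lt (+-monoˡ-≤ (sum (f ∘ suc)) (≮⇒≥ x≮f₀))))
  ... | i , x<fᵢ = suc i , x<fᵢ

  count-extract : ∀ {n} k (b : Fin n → Bool) → k ≤ sum (λ i → 𝟙 (b i)) →
    Σ (Fin k → Fin n) λ g → (∀ {i j} → g i ≡ g j → i ≡ j) × (∀ i → b (g i) ≡ true)
  count-extract zero b _ = (λ ()) , (λ { {()} }) , λ ()
  count-extract {suc n} (suc k) b le with b zero in eq
  ... | false with count-extract (suc k) (b ∘ suc) le
  ...   | g , inj , ok = suc ∘ g , inj ∘ suc-injective , ok
  count-extract {suc n} (suc k) b (s≤s le) | true with count-extract k (b ∘ suc) le
  ...   | g , inj , ok = g′ , inj′ , ok′
    where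
    g′ : Fin (suc k) → Fin (suc n)
    g′ zero    = zero
    g′ (suc i) = suc (g i)
    inj′ : ∀ {i j} → g′ i ≡ g′ j → i ≡ j
    inj′ {zero}  {zero}  _ = refl
    inj′ {suc i} {suc j} e = cong suc (inj (suc-injective e))
    ok′ : ∀ i → b (g′ i) ≡ true
    ok′ zero    = eq
    ok′ (suc i) = ok i

count-split : ∀ {n} (b : Fin n → Bool) → sum (λ i → 𝟙 (b i)) + sum (λ i → 𝟙 (not (b i))) ≡ n
count-split {n} b = trans (≡.sym (sum-+ (𝟙 ∘ b) (𝟙 ∘ not ∘ b))) (trans (sum-cong (one ∘ b)) (trans (sum-const n 1) (*-identityʳ n)))
  where
  one : ∀ b → 𝟙 b + 𝟙 (not b) ≡ 1
  one true  = refl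
  one false = refl


-- Pigeonhole, where the colour of a good index may depend on the proof that it is good. It serves
-- to find many fibres on which one and the same finite choice works.
popular-colour : ∀ {M Y} {P : Fin M → Fin Y → Set} T (good : Fin M → Bool) →
  (∀ t → good t ≡ true → ∃ λ y → P t y) → Y * T < sum (λ t → 𝟙 (good t)) →
  ∃ λ y → Σ (Fin T → Fin M) λ τ → (∀ {i j} → τ i ≡ τ j → i ≡ j) × (∀ i → P (τ i) y)
popular-colour {M} {Y} {P} T good colour many = y , τ , τ-inj , λ i → colour→P (τ i) (τ-ok i)
  where
  hasColour′ : ∀ t b → good t ≡ b → Fin Y → Bool
  hasColour′ t true  eq y = does (y ≟ proj₁ (colour t eq))
  hasColour′ t false eq y = false

  hasColour : Fin M → Fin Y → Bool
  hasColour t = hasColour′ t (good t) refl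

  hasColour→P : ∀ t y b eq → hasColour′ t b eq y ≡ true → P t y
  hasColour→P t y true eq h with y ≟ proj₁ (colour t eq)
  ... | yes refl = proj₂ (colour t eq)
  hasColour→P t y true eq () | no _

  one-colour : ∀ t b eq → 𝟙 b ≡ sum (λ y → 𝟙 (hasColour′ t b eq y))
  one-colour t true  eq = ≡.sym (trans (sum-cong (λ y → ≡.sym (*-identityʳ _))) (sum-δ (proj₁ (colour t eq)) (λ _ → 1)))
  one-colour t false eq = ≡.sym (sum-zero Y)

  total : sum (λ t → 𝟙 (good t)) ≡ sum (λ y → sum (λ t → 𝟙 (hasColour t y)))
  total = trans (sum-cong (λ t → one-colour t (good t) refl)) (sum-comm (λ t y → 𝟙 (hasColour t y)))

  popular : ∃ λ y → T < sum (λ t → 𝟙 (hasColour t y))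
  popular = large-term T (λ y → sum (λ t → 𝟙 (hasColour t y))) (subst (Y * T <_) total many)

  y : Fin Y
  y = proj₁ popular

  extracted = count-extract T (λ t → hasColour t y) (<⇒≤ (proj₂ popular))
  τ = proj₁ extracted
  τ-inj = proj₁ (proj₂ extracted)
  τ-ok = proj₂ (proj₂ extracted)

  colour→P : ∀ t → hasColour t y ≡ true → P t y
  colour→P t = hasColour→P t y (good t) refl

-- Finite products and the discrete cube

abstract
  prod : ∀ {n} → (Fin n → ℕ) → ℕ
  prod {zero}  f = 1
  prod {suc n} f = f zero * prod (f ∘ suc)

  prod-empty : (f : Fin 0 → ℕ) → prod f ≡ 1
  prod-empty f = refl

  prod-suc : ∀ {n} (f : Fin (suc n) → ℕ) → prod f ≡ f zero * prod (f ∘ suc)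
  prod-suc f = refl

  prod-cong : ∀ {n} {f g : Fin n → ℕ} → (∀ i → f i ≡ g i) → prod f ≡ prod g
  prod-cong {zero}  f≗g = refl
  prod-cong {suc n} f≗g = cong₂ _*_ (f≗g zero) (prod-cong (f≗g ∘ suc))

  prod-const : ∀ n x → prod {n} (λ _ → x) ≡ x ^ n
  prod-const zero    x = refl
  prod-const (suc n) x = cong (x *_) (prod-const n x)

  prod-change : ∀ {n} (f f′ : Fin n → ℕ) i → (∀ j → j ≢ i → f′ j ≡ f j) → prod f′ * f i ≡ prod f * f′ i
  prod-change {suc n} f f′ zero agree =
    trans (cong (λ p → f′ zero * p * f zero) (prod-cong (λ j → agree (suc j) λ ())))
      (solve 3 (λ a p b → a :* p :* b := b :* p :* a) refl (f′ zero) (prod (f ∘ suc)) (f zero))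
  prod-change {suc n} f f′ (suc i) agree = begin
    f′ zero * prod (f′ ∘ suc) * f (suc i)    ≡⟨ *-assoc (f′ zero) _ _ ⟩
    f′ zero * (prod (f′ ∘ suc) * f (suc i))  ≡⟨ cong₂ _*_ (agree zero λ ()) (prod-change (f ∘ suc) (f′ ∘ suc) i (λ j j≢i → agree (suc j) (j≢i ∘ suc-injective))) ⟩
    f zero * (prod (f ∘ suc) * f′ (suc i))   ≡⟨ *-assoc (f zero) _ _ ⟨
    f zero * prod (f ∘ suc) * f′ (suc i)     ∎
    where open ≡-Reasoning

  prod-if : ∀ {n} (β : Fin n → Bool) a b →
    prod (λ i → if β i then a else b) ≡ a ^ sum (λ i → 𝟙 (β i)) * b ^ (n ∸ sum (λ i → 𝟙 (β i)))
  prod-if {n} β a b = trans (go β) (cong (λ t → a ^ sum (𝟙 ∘ β) * b ^ t)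
      (≡.sym (trans (cong (_∸ sum (𝟙 ∘ β)) (≡.sym (count-split β))) (m+n∸m≡n (sum (𝟙 ∘ β)) _))))
    where
    go : ∀ {n} (β : Fin n → Bool) →
      prod (λ i → if β i then a else b) ≡ a ^ sum (λ i → 𝟙 (β i)) * b ^ sum (λ i → 𝟙 (not (β i)))
    go {zero}  β = ≡.sym (cong₂ (λ s t → a ^ s * b ^ t) (sum-empty (𝟙 ∘ β)) (sum-empty (𝟙 ∘ not ∘ β)))
    go {suc n} β = trans (cong ((if β zero then a else b) *_) (go (β ∘ suc)))
      (trans (step (β zero)) (≡.sym (cong₂ (λ s t → a ^ s * b ^ t) (sum-suc (𝟙 ∘ β)) (sum-suc (𝟙 ∘ not ∘ β)))))
      where
      s t : ℕ
      s = sum (λ i → 𝟙 (β (suc i)))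
      t = sum (λ i → 𝟙 (not (β (suc i))))
      step : ∀ c → (if c then a else b) * (a ^ s * b ^ t) ≡ a ^ (𝟙 c + s) * b ^ (𝟙 (not c) + t)
      step true  = ≡.sym (*-assoc a _ _)
      step false = solve 3 (λ a b c → b :* (a :* c) := a :* (b :* c)) refl (a ^ s) b (b ^ t)

  prod-one : ∀ {n} (f : Fin n → ℕ) → (∀ i → f i ≡ 1) → prod f ≡ 1
  prod-one {n} f f≗1 = trans (prod-cong f≗1) (trans (prod-const n 1) (^-zeroˡ n))

toBool : Fin 2 → Bool
toBool zero    = false
toBool (suc _) = true

fromBool : Bool → Fin 2
fromBool false = zero
fromBool true  = suc zero

toBool-fromBool : ∀ b → toBool (fromBool b) ≡ b
toBool-fromBool false = refl
toBool-fromBool true  = refl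

bit : ∀ {n} → Fin (2 ^ n) → Fin n → Bool
bit z i = toBool (finToFun z i)

code : ∀ {n} → (Fin n → Bool) → Fin (2 ^ n)
code y = funToFin (fromBool ∘ y)

bit-code : ∀ {n} (y : Fin n → Bool) i → bit (code y) i ≡ y i
bit-code y i = trans (cong toBool (finToFun-funToFin (fromBool ∘ y) i)) (toBool-fromBool (y i))

-- Expanding the product of the sums `Φ i false + Φ i true` gives one term for each point of the
-- cube; equivalently, the coordinates of a random point are independent.
cube-prod : ∀ n (Φ : Fin n → Bool → ℕ) →
  sum {2 ^ n} (λ z → prod (λ i → Φ i (bit z i))) ≡ prod (λ i → Φ i false + Φ i true)
cube-prod zero    Φ = trans (sum-cong (λ _ → prod-empty _)) (trans (sum-const 1 1) (≡.sym (prod-empty _)))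
cube-prod (suc n) Φ = begin
  sum {2 ^ suc n} (λ z → prod (λ i → Φ i (bit z i)))
    ≡⟨ sum-combine 2 (2 ^ n) _ ⟩
  sum {2} (λ b → sum {2 ^ n} (λ z → prod (λ i → Φ i (bit (combine b z) i))))
    ≡⟨ sum-cong (λ b → trans (sum-cong (peel b)) (≡.sym (sum-*ˡ (Φ zero (toBool b)) _))) ⟩
  sum {2} (λ b → Φ zero (toBool b) * sum {2 ^ n} (λ z → prod (λ i → Φ (suc i) (bit z i))))
    ≡⟨ sum-cong (λ b → cong (Φ zero (toBool b) *_) (cube-prod n (Φ ∘ suc))) ⟩
  sum {2} (λ b → Φ zero (toBool b) * P)
    ≡⟨ trans (sum-suc _) (cong (Φ zero false * P +_) (trans (sum-suc _) (trans (cong (Φ zero true * P +_) (sum-empty _)) (+-identityʳ _)))) ⟩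
  Φ zero false * P + Φ zero true * P
    ≡⟨ *-distribʳ-+ P (Φ zero false) (Φ zero true) ⟨
  (Φ zero false + Φ zero true) * P
    ≡⟨ prod-suc _ ⟨
  prod (λ i → Φ i false + Φ i true) ∎
  where
  open ≡-Reasoning
  P = prod (λ i → Φ (suc i) false + Φ (suc i) true)
  peel : ∀ (b : Fin 2) (z : Fin (2 ^ n)) →
    prod (λ i → Φ i (bit (combine b z) i)) ≡ Φ zero (toBool b) * prod (λ i → Φ (suc i) (bit z i))
  peel b z = trans (prod-suc _) (cong₂ _*_
    (cong (λ rq → Φ zero (toBool (proj₁ rq))) (remQuot-combine b z))
    (prod-cong (λ i → cong (λ rq → Φ (suc i) (bit (proj₂ rq) i)) (remQuot-combine b z))))

-- Coordinate i carries the factor φ c if i = g c, and the trivial factor if i is not a value of g.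
spread : ∀ {N n} → (Fin N → Fin n) → (Fin N → Bool → ℕ) → Fin n → Bool → ℕ
spread {zero}  g φ = λ _ _ → 1
spread {suc N} g φ = updateAt (spread (g ∘ suc) (φ ∘ suc)) (g zero) (const (φ zero))

spread-off : ∀ {N n} (g : Fin N → Fin n) φ i → (∀ c → i ≢ g c) → spread g φ i ≡ (λ _ → 1)
spread-off {zero}  g φ i i∉g = refl
spread-off {suc N} g φ i i∉g =
  trans (updateAt-minimal i (g zero) (spread (g ∘ suc) (φ ∘ suc)) (i∉g zero)) (spread-off (g ∘ suc) (φ ∘ suc) i (i∉g ∘ suc))

module _ {n : ℕ} where

  private
    Inj : ∀ {N} → (Fin N → Fin n) → Set
    Inj g = ∀ {c d} → g c ≡ g d → c ≡ d

    tail-off : ∀ {N} (g : Fin (suc N) → Fin n) → Inj g → ∀ c → g zero ≢ g (suc c)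
    tail-off g inj c eq with inj eq
    ... | ()

  prod-spread : ∀ {N} (g : Fin N → Fin n) → Inj g → ∀ φ (y : Fin n → Bool) →
    prod (λ i → spread g φ i (y i)) ≡ prod (λ c → φ c (y (g c)))
  prod-spread {zero}  g inj φ y = trans (prod-one _ (λ _ → refl)) (≡.sym (prod-empty _))
  prod-spread {suc N} g inj φ y = begin
    prod (λ i → spread g φ i (y i))
      ≡⟨ *-identityʳ _ ⟨
    prod (λ i → spread g φ i (y i)) * 1
      ≡⟨ cong (λ f → prod (λ i → spread g φ i (y i)) * f (y (g zero))) (spread-off (g ∘ suc) (φ ∘ suc) (g zero) (tail-off g inj)) ⟨
    prod (λ i → spread g φ i (y i)) * old (g zero) (y (g zero))
      ≡⟨ prod-change (λ i → old i (y i)) _ (g zero) (λ j j≢ → cong (λ f → f (y j)) (updateAt-minimal j (g zero) old j≢)) ⟩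
    prod (λ i → old i (y i)) * spread g φ (g zero) (y (g zero))
      ≡⟨ cong₂ _*_ (prod-spread (g ∘ suc) (suc-injective ∘ inj) (φ ∘ suc) y) (cong (λ f → f (y (g zero))) (updateAt-updates (g zero) old)) ⟩
    prod (λ c → φ (suc c) (y (g (suc c)))) * φ zero (y (g zero))
      ≡⟨ *-comm _ (φ zero (y (g zero))) ⟩
    φ zero (y (g zero)) * prod (λ c → φ (suc c) (y (g (suc c))))
      ≡⟨ prod-suc _ ⟨
    prod (λ c → φ c (y (g c))) ∎
    where
    open ≡-Reasoning
    old = spread (g ∘ suc) (φ ∘ suc)

  -- Every coordinate outside the image of `g` contributes `1 + 1`, which makes a factor
  -- `2 ^ (n - N)`; multiplying by `2 ^ N` avoids the subtraction.
  prod-spread-total : ∀ {N} (g : Fin N → Fin n) → Inj g → ∀ φ →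
    prod (λ i → spread g φ i false + spread g φ i true) * 2 ^ N ≡ 2 ^ n * prod (λ c → φ c false + φ c true)
  prod-spread-total {zero} g inj φ = cong₂ _*_ (prod-const n 2) (≡.sym (prod-empty _))
  prod-spread-total {suc N} g inj φ = begin
    prod new₂ * (2 * 2 ^ N)
      ≡⟨ *-assoc (prod new₂) 2 (2 ^ N) ⟨
    prod new₂ * 2 * 2 ^ N
      ≡⟨ cong (λ f → prod new₂ * (f false + f true) * 2 ^ N) (spread-off (g ∘ suc) (φ ∘ suc) (g zero) (tail-off g inj)) ⟨
    prod new₂ * old₂ (g zero) * 2 ^ N
      ≡⟨ cong (_* 2 ^ N) (prod-change old₂ new₂ (g zero) (λ j j≢ → cong (λ f → f false + f true) (updateAt-minimal j (g zero) old j≢))) ⟩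
    prod old₂ * new₂ (g zero) * 2 ^ N
      ≡⟨ cong (λ f → prod old₂ * (f false + f true) * 2 ^ N) (updateAt-updates (g zero) old) ⟩
    prod old₂ * φ₂ * 2 ^ N
      ≡⟨ solve 3 (λ a b c → a :* b :* c := b :* (a :* c)) refl (prod old₂) φ₂ (2 ^ N) ⟩
    φ₂ * (prod old₂ * 2 ^ N)
      ≡⟨ cong (φ₂ *_) (prod-spread-total (g ∘ suc) (suc-injective ∘ inj) (φ ∘ suc)) ⟩
    φ₂ * (2 ^ n * prod (λ c → φ (suc c) false + φ (suc c) true))
      ≡⟨ solve 3 (λ a b c → a :* (b :* c) := b :* (a :* c)) refl φ₂ (2 ^ n) (prod (λ c → φ (suc c) false + φ (suc c) true)) ⟩
    2 ^ n * (φ₂ * prod (λ c → φ (suc c) false + φ (suc c) true))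
      ≡⟨ cong (2 ^ n *_) (prod-suc _) ⟨
    2 ^ n * prod (λ c → φ c false + φ c true) ∎
    where
    open ≡-Reasoning
    old = spread (g ∘ suc) (φ ∘ suc)
    old₂ new₂ : Fin n → ℕ
    old₂ i = old i false + old i true
    new₂ i = spread g φ i false + spread g φ i true
    φ₂ = φ zero false + φ zero true

  -- The values of a uniform point at `N` distinct coordinates form a uniform point of the smaller
  -- cube.
  cube-prod-inj : ∀ {N} (g : Fin N → Fin n) → Inj g → ∀ φ →
    sum {2 ^ n} (λ z → prod (λ c → φ c (bit z (g c)))) * 2 ^ N ≡ 2 ^ n * prod (λ c → φ c false + φ c true)
  cube-prod-inj {N} g inj φ =
    trans (cong (_* 2 ^ N) (trans (sum-cong (λ z → ≡.sym (prod-spread g inj φ (bit {n} z)))) (cube-prod n (spread g φ))))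
      (prod-spread-total g inj φ)

  cylinder : ∀ {N} (g : Fin N → Fin n) → Inj g → (x : Fin N → Bool) →
    sum {2 ^ n} (λ z → prod (λ c → 𝟙 (does (bit z (g c) ≟ᵇ x c)))) * 2 ^ N ≡ 2 ^ n
  cylinder g inj x = trans (cube-prod-inj g inj (λ c b → 𝟙 (does (b ≟ᵇ x c))))
    (trans (cong (2 ^ n *_) (prod-one _ (λ c → one (x c)))) (*-identityʳ (2 ^ n)))
    where
    one : ∀ b → 𝟙 (does (false ≟ᵇ b)) + 𝟙 (does (true ≟ᵇ b)) ≡ 1
    one false = refl
    one true  = refl

dist : ∀ {N} → (Fin N → Bool) → (Fin N → Bool) → ℕ
dist y x = sum (λ c → 𝟙 (y c xor x c))

-- Chernoff's method: a Hamming ball is compared with the total weight Σ b^dist (b+1)^(N-dist) = (2b+1)^N.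
ball-tail : ∀ {N n} (g : Fin N → Fin n) → (∀ {c d} → g c ≡ g d → c ≡ d) → (x : Fin N → Bool) → ∀ b r → r ≤ N →
  sum {2 ^ n} (λ z → 𝟙 (does (dist (bit z ∘ g) x ≤? r))) * (b ^ r * suc b ^ (N ∸ r) * 2 ^ N) ≤ 2 ^ n * (b + suc b) ^ N
ball-tail {N} {n} g inj x b r r≤N = begin
  sum (λ z → ball z) * (w * 2 ^ N)        ≡⟨ *-assoc (sum ball) w (2 ^ N) ⟨
  sum (λ z → ball z) * w * 2 ^ N          ≡⟨ cong (_* 2 ^ N) (trans (*-comm (sum ball) w) (sum-*ˡ w ball)) ⟩
  sum (λ z → w * ball z) * 2 ^ N          ≤⟨ *-monoˡ-≤ (2 ^ N) (sum-mono bound) ⟩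
  sum (λ z → prod (λ c → φ c (bit z (g c)))) * 2 ^ N ≡⟨ cube-prod-inj g inj φ ⟩
  2 ^ n * prod (λ c → φ c false + φ c true) ≡⟨ cong (2 ^ n *_) (trans (prod-cong (λ c → total (x c))) (prod-const N (b + suc b))) ⟩
  2 ^ n * (b + suc b) ^ N ∎
  where
  open ≤-Reasoning
  w = b ^ r * suc b ^ (N ∸ r)
  ball : Fin (2 ^ n) → ℕ
  ball z = 𝟙 (does (dist (bit z ∘ g) x ≤? r))
  φ : Fin N → Bool → ℕ
  φ c β = if β xor x c then b else suc b
  total : ∀ β → (if false xor β then b else suc b) + (if true xor β then b else suc b) ≡ b + suc b
  total true  = refl
  total false = +-comm (suc b) b
  bound : ∀ z → w * ball z ≤ prod (λ c → φ c (bit z (g c)))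
  bound z with dist (bit z ∘ g) x ≤? r
  ... | no  d≰r = ≤-trans (≤-reflexive (trans (cong (λ t → w * 𝟙 t) (dec-false (dist (bit z ∘ g) x ≤? r) d≰r)) (*-zeroʳ w))) z≤n
  ... | yes d≤r = begin
    w * ball z                                      ≤⟨ *-monoʳ-≤ w (𝟙≤1 (does (dist (bit z ∘ g) x ≤? r))) ⟩
    w * 1                                           ≡⟨ *-identityʳ w ⟩
    b ^ r * suc b ^ (N ∸ r)                         ≡⟨ cong (λ e → b ^ e * suc b ^ (N ∸ r)) (≡.sym (m+[n∸m]≡n d≤r)) ⟩
    b ^ (d + (r ∸ d)) * suc b ^ (N ∸ r)             ≡⟨ cong (_* suc b ^ (N ∸ r)) (^-distribˡ-+-* b d (r ∸ d)) ⟩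
    b ^ d * b ^ (r ∸ d) * suc b ^ (N ∸ r)           ≤⟨ *-monoˡ-≤ (suc b ^ (N ∸ r)) (*-monoʳ-≤ (b ^ d) (^-monoˡ-≤ (r ∸ d) (n≤1+n b))) ⟩
    b ^ d * suc b ^ (r ∸ d) * suc b ^ (N ∸ r)       ≡⟨ *-assoc (b ^ d) _ _ ⟩
    b ^ d * (suc b ^ (r ∸ d) * suc b ^ (N ∸ r))     ≡⟨ cong (b ^ d *_) (^-distribˡ-+-* (suc b) (r ∸ d) (N ∸ r)) ⟨
    b ^ d * suc b ^ ((r ∸ d) + (N ∸ r))             ≡⟨ cong (λ e → b ^ d * suc b ^ e) exponent ⟩
    b ^ d * suc b ^ (N ∸ d)                         ≡⟨ prod-if (λ c → bit z (g c) xor x c) b (suc b) ⟨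
    prod (λ c → φ c (bit z (g c)))                  ∎
    where
    d = dist (bit z ∘ g) x
    exponent : (r ∸ d) + (N ∸ r) ≡ N ∸ d
    exponent = trans (+-comm (r ∸ d) (N ∸ r)) (trans (≡.sym (+-∸-assoc (N ∸ r) d≤r)) (cong (_∸ d) (m∸n+n≡m r≤N)))

-- Shattered transversals

module _ {E : Set} where

  Differ : ∀ {N} → (E → Fin N → Bool) → E → E → Set
  Differ x e e′ = ∃ λ c → x e c ≢ x e′ c

  Separated : ∀ {N} → (E → Fin N → Bool) → List E → List E → Set
  Separated x g g′ = ∃₂ λ c b → (∀ {e} → e ∈ g → x e c ≡ b) × (∀ {e} → e ∈ g′ → x e c ≡ not b)

  length-filter-split : (β : E → Bool) (xs : List E) →
    length xs ≡ length (filter (λ e → β e ≟ᵇ false) xs) + length (filter (λ e → β e ≟ᵇ true) xs)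
  length-filter-split β [] = refl
  length-filter-split β (e ∷ xs) with β e
  ... | false = cong suc (length-filter-split β xs)
  ... | true  = trans (cong suc (length-filter-split β xs)) (≡.sym (+-suc _ _))

  -- The groups are the minimal large subtrees of the binary trie of the vectors x e.
  separated-groups : ∀ {N} (x : E → Fin N → Bool) s → 1 ≤ s → (M : List E) → Unique M →
    (∀ {e e′} → e ∈ M → e′ ∈ M → e ≢ e′ → Differ x e e′) →
    ∃ λ gs → All (λ g → Unique g × (∀ {e} → e ∈ g → e ∈ M) × s < length g) gs ×
      AllPairs (Separated x) gs × length M ≤ length gs * (s * suc N) + s
  separated-groups {zero} x s 1≤s [] uniq diff = [] , [] , [] , z≤n
  separated-groups {zero} x s 1≤s (e ∷ []) uniq diff = [] , [] , [] , 1≤s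
  separated-groups {zero} x s 1≤s (e ∷ e′ ∷ M) ((e≢e′ ∷ _) ∷ _) diff
    with diff (here refl) (there (here refl)) e≢e′
  ... | () , _
  separated-groups {suc N} x s 1≤s M uniq diff = result (gs₀ ++ gs₁) refl
    where
    sub : Bool → List E
    sub b = filter (λ e → x e zero ≟ᵇ b) M

    recurse : ∀ b → _
    recurse b = separated-groups (λ e → x e ∘ suc) s 1≤s (sub b) (Unique.filter⁺ (λ e → x e zero ≟ᵇ b) uniq) diff′
      where
      diff′ : ∀ {e e′} → e ∈ sub b → e′ ∈ sub b → e ≢ e′ → Differ (λ e → x e ∘ suc) e e′
      diff′ e∈ e′∈ e≢e′ with ∈-filter⁻ (λ e → x e zero ≟ᵇ b) {xs = M} e∈ | ∈-filter⁻ (λ e → x e zero ≟ᵇ b) {xs = M} e′∈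
      ... | e∈M , xe | e′∈M , xe′ with diff e∈M e′∈M e≢e′
      ...   | zero  , ne = contradiction (trans xe (≡.sym xe′)) ne
      ...   | suc c , ne = c , ne

    gs₀ gs₁ : List (List E)
    gs₀ = proj₁ (recurse false)
    gs₁ = proj₁ (recurse true)

    In : ∀ b {g} → (Unique g × (∀ {e} → e ∈ g → e ∈ sub b) × s < length g) →
      (Unique g × (∀ {e} → e ∈ g → e ∈ M) × s < length g) × (∀ {e} → e ∈ g → x e zero ≡ b)
    In b (u , ⊆sub , big) =
      (u , (λ e∈ → proj₁ (∈-filter⁻ (λ e → x e zero ≟ᵇ b) {xs = M} (⊆sub e∈))) , big) ,
      λ e∈ → proj₂ (∈-filter⁻ (λ e → x e zero ≟ᵇ b) {xs = M} (⊆sub e∈))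

    all₀ = All.map (In false) (proj₁ (proj₂ (recurse false)))
    all₁ = All.map (In true) (proj₁ (proj₂ (recurse true)))

    lift : ∀ {g g′} → Separated (λ e → x e ∘ suc) g g′ → Separated x g g′
    lift (c , rest) = suc c , rest

    pairs : AllPairs (Separated x) (gs₀ ++ gs₁)
    pairs = AllPairs.++⁺ (AP.map lift (proj₁ (proj₂ (proj₂ (recurse false)))))
      (AP.map lift (proj₁ (proj₂ (proj₂ (recurse true)))))
      (All.map (λ p → All.map (λ q → zero , false , proj₂ p , proj₂ q) all₁) all₀)

    lengths : length M ≤ (length gs₀ * (s * suc N) + s) + (length gs₁ * (s * suc N) + s)
    lengths = ≤-trans (≤-reflexive (length-filter-split (λ e → x e zero) M))
      (+-mono-≤ (proj₂ (proj₂ (proj₂ (recurse false)))) (proj₂ (proj₂ (proj₂ (recurse true)))))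

    total : length M ≤ length (gs₀ ++ gs₁) * (s * suc N) + (s + s)
    total = ≤-trans lengths (≤-reflexive (trans
      (solve 4 (λ a b k s → a :* k :+ s :+ (b :* k :+ s) := (a :+ b) :* k :+ (s :+ s)) refl (length gs₀) (length gs₁) (s * suc N) s)
      (cong (λ l → l * (s * suc N) + (s + s)) (≡.sym (length-++ gs₀)))))

    result : ∀ gs → gs ≡ gs₀ ++ gs₁ → _
    -- When neither half contains a group, each has at most `s` elements, and `M` itself is the only
    -- candidate.
    result [] eq with s <? length M
    ... | yes s<M = M ∷ [] , (uniq , id , s<M) ∷ [] , [] ∷ [] , (begin
        length M                       ≤⟨ subst (λ gs → length M ≤ length gs * (s * suc N) + (s + s)) (≡.sym eq) total ⟩
        s + s                          ≤⟨ +-monoˡ-≤ s (≤-trans (m≤m*n s (suc (suc N))) (m≤m+n _ 0)) ⟩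
        1 * (s * suc (suc N)) + s      ∎)
        where open ≤-Reasoning
    ... | no  s≮M = [] , [] , [] , ≮⇒≥ s≮M
    -- The two remainders `s + s` exceed the allowed `s` by one `s`, which is charged to the groups
    -- at this level; there is at least one.
    result (g ∷ gs) eq = g ∷ gs ,
      subst (All _) (≡.sym eq) (All.++⁺ (All.map proj₁ all₀) (All.map proj₁ all₁)) ,
      subst (AllPairs _) (≡.sym eq) pairs , (begin
        length M                                 ≤⟨ subst (λ gs → length M ≤ length gs * (s * suc N) + (s + s)) (≡.sym eq) total ⟩
        suc l * (s * suc N) + (s + s)            ≡⟨ solve 3 (λ a b s → a :+ (s :+ s) := s :+ a :+ s) refl (suc l * (s * suc N)) l s ⟩
        s + suc l * (s * suc N) + s              ≤⟨ +-monoˡ-≤ s (+-monoˡ-≤ _ (m≤m+n s (l * s))) ⟩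
        suc l * s + suc l * (s * suc N) + s      ≡⟨ cong (_+ s) (≡.sym (trans (cong (suc l *_) (*-suc s (suc N))) (*-distribˡ-+ (suc l) s (s * suc N)))) ⟩
        suc l * (s * suc (suc N)) + s            ∎)
      where
      open ≤-Reasoning
      l = length gs

AllPairs-lookup : ∀ {A : Set} {R : A → A → Set} {xs : List A} → AllPairs R xs →
  ∀ {i j} → toℕ i < toℕ j → R (lookup xs i) (lookup xs j)
AllPairs-lookup {xs = x ∷ xs} (r ∷ rs) {zero}  {suc j} _         = All.lookup r (∈-lookup j)
AllPairs-lookup {xs = x ∷ xs} (r ∷ rs) {suc i} {suc j} (s≤s i<j) = AllPairs-lookup rs i<j

-- Every element of E carries R vectors of length N; a transversal c chooses one coordinate of each.
Shatters : ∀ {E : Set} {R N} → List E → (E → Fin R → Fin N → Bool) → (Fin R → Bool) → (Fin R → Fin N) → Set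
Shatters {R = R} S sv J c = ∀ (π : Fin R → Bool) → ∃ λ e → e ∈ S × (∀ j → J j ≡ true → sv e j (c j) ≡ π j)

-- A family above the threshold for `R + 1` classes splits, by its vectors in the first class, into
-- more than `N ^ R` separated groups, each still above the threshold for `R` classes.
matchingBound : ℕ → ℕ → ℕ
matchingBound N zero    = 1
matchingBound N (suc R) = N ^ R * (matchingBound N R * suc N) + matchingBound N R

1≤matchingBound : ∀ N R → 1 ≤ matchingBound N R
1≤matchingBound N zero    = s≤s z≤n
1≤matchingBound N (suc R) = ≤-trans (1≤matchingBound N R) (m≤n+m _ (N ^ R * (matchingBound N R * suc N)))

module _ {E : Set} {N : ℕ} (d : Fin N) where

  private
    _▹_ : ∀ {A : Set} {R} → A → (Fin R → A) → Fin (suc R) → A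
    (a ▹ f) zero    = a
    (a ▹ f) (suc i) = f i

  -- Of more than N^R separated groups, two shatter the same transversal of the remaining classes,
  -- and the coordinate separating these two groups completes it.
  matching-shatters : ∀ {R} (sv : E → Fin R → Fin N → Bool) (J : Fin R → Bool) (M : List E) → Unique M →
    (∀ {e e′} → e ∈ M → e′ ∈ M → e ≢ e′ → ∀ j → J j ≡ true → Differ (λ e → sv e j) e e′) →
    matchingBound N R < length M → ∃ λ c → Shatters M sv J c
  matching-shatters {zero}  sv J (e ∷ M) uniq diff _ = (λ ()) , λ π → e , here refl , λ ()
  matching-shatters {suc R} sv J M uniq diff large with J zero in Jzero
  -- Class zero lies outside `J`, so its coordinate is the arbitrary default `d`.
  ... | false = let c , sh = matching-shatters (λ e → sv e ∘ suc) (J ∘ suc) M uniq (λ e∈ e′∈ ne j → diff e∈ e′∈ ne (suc j))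
                                (≤-<-trans (m≤n+m _ (N ^ R * (matchingBound N R * suc N))) large)
                in d ▹ c , λ π → let e , e∈ , ok = sh (π ∘ suc) in e , e∈ , λ
                  { zero Jz → contradiction (trans (≡.sym Jzero) Jz) λ ()
                  ; (suc j) Jj → ok j Jj }
  ... | true = conclude (pigeonhole (≰⇒> many) colour)
    where
    groups : _
    groups = separated-groups (λ e → sv e zero) (matchingBound N R) (1≤matchingBound N R) M uniq
      (λ e∈ e′∈ ne → diff e∈ e′∈ ne zero Jzero)

    gs : List (List E)
    gs = proj₁ groups

    many : ¬ (length gs ≤ N ^ R)
    many few = <⇒≱ large (≤-trans (proj₂ (proj₂ (proj₂ groups)))
      (+-monoˡ-≤ (matchingBound N R) (*-monoˡ-≤ (matchingBound N R * suc N) few)))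

    ⊆M : ∀ i {e} → e ∈ lookup gs i → e ∈ M
    ⊆M i = proj₁ (proj₂ (All.lookup (proj₁ (proj₂ groups)) (∈-lookup i)))

    rec : ∀ i → ∃ λ c → Shatters (lookup gs i) (λ e → sv e ∘ suc) (J ∘ suc) c
    rec i with All.lookup (proj₁ (proj₂ groups)) (∈-lookup i)
    ... | u , ⊆ , big = matching-shatters (λ e → sv e ∘ suc) (J ∘ suc) (lookup gs i) u
      (λ e∈ e′∈ ne j → diff (⊆ e∈) (⊆ e′∈) ne (suc j)) big

    colour : Fin (length gs) → Fin (N ^ R)
    colour i = funToFin (proj₁ (rec i))

    conclude : (∃₂ λ i j → toℕ i < toℕ j × colour i ≡ colour j) → ∃ λ c → Shatters M sv J c
    conclude (i , j , i<j , same) with AllPairs-lookup (proj₁ (proj₂ (proj₂ groups))) i<j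
    ... | u , b , onᵢ , onⱼ = u ▹ c , sh
      where
      c : Fin R → Fin N
      c = proj₁ (rec i)

      c≗ : ∀ l → proj₁ (rec j) l ≡ c l
      c≗ l = trans (≡.sym (finToFun-funToFin (proj₁ (rec j)) l))
        (trans (cong (λ y → finToFun y l) (≡.sym same)) (finToFun-funToFin c l))

      sh : Shatters M sv J (u ▹ c)
      sh π with π zero ≟ᵇ b
      ... | yes π₀≡b with proj₂ (rec i) (π ∘ suc)
      ...   | e , e∈ , ok = e , ⊆M i e∈ , λ { zero _ → trans (onᵢ e∈) (≡.sym π₀≡b) ; (suc l) Jl → ok l Jl }
      sh π | no π₀≢b with proj₂ (rec j) (π ∘ suc)
      ...   | e , e∈ , ok = e , ⊆M j e∈ , λ
        { zero _ → trans (onⱼ e∈) (≡.sym (¬-not π₀≢b))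
        ; (suc l) Jl → trans (cong (sv e (suc l)) (≡.sym (c≗ l))) (ok l Jl) }

  module _ {R : ℕ} (sv : E → Fin R → Fin N → Bool) where

    Covered : (Fin R → Bool) → (Fin R → List (Fin N → Bool)) → E → Set
    Covered J X e = ∃ λ j → J j ≡ true × Any (λ x → sv e j ≗ x) (X j)

    private
      Agree : (Fin R → Bool) → E → E → Set
      Agree J e e′ = ∃ λ j → J j ≡ true × sv e j ≗ sv e′ j

      agree? : ∀ J e e′ → Dec (Agree J e e′)
      agree? J e e′ = any? λ j → (J j ≟ᵇ true) ×-dec all? λ c → sv e j c ≟ᵇ sv e′ j c

      disagree : ∀ {J e e′} → ¬ Agree J e e′ → ∀ j → J j ≡ true → Differ (λ e → sv e j) e e′
      disagree {J} {e} {e′} ne j Jj = ¬∀⟶∃¬ N _ (λ c → sv e j c ≟ᵇ sv e′ j c) λ same → ne (j , Jj , same)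

      -- An element is regarded as a hyperedge with one vertex, its vector, in each class of `J`.
      -- Greedy choice gives a maximal set of disjoint hyperedges; since `J` is nonempty, every
      -- hyperedge meets itself.
      maximal-matching : ∀ J → (∃ λ j → J j ≡ true) → (S : List E) → ∃ λ M → Unique M ×
        (∀ {e} → e ∈ M → e ∈ S) ×
        (∀ {e e′} → e ∈ M → e′ ∈ M → e ≢ e′ → ∀ j → J j ≡ true → Differ (λ e → sv e j) e e′) ×
        (∀ {e} → e ∈ S → Any (Agree J e) M)
      maximal-matching J (j₀ , Jj₀) [] = [] , [] , id , (λ ()) , λ ()
      maximal-matching J (j₀ , Jj₀) (s ∷ S) with maximal-matching J (j₀ , Jj₀) S
      ... | M , uniq , ⊆S , diff , max with Any.any? (agree? J s) M
      ...   | yes a = M , uniq , there ∘ ⊆S , diff , λ { (here refl) → a ; (there e∈) → max e∈ }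
      ...   | no ¬a = s ∷ M , All.map (λ ne eq → ne (subst (Agree J s) eq (j₀ , Jj₀ , λ _ → refl))) fresh ∷ uniq ,
        (λ { (here eq) → here eq ; (there e∈) → there (⊆S e∈) }) , diff′ ,
        λ { (here refl) → here (j₀ , Jj₀ , λ _ → refl) ; (there e∈) → there (max e∈) }
        where
        fresh : All (λ e → ¬ Agree J s e) M
        fresh = All.¬Any⇒All¬ M ¬a

        diff′ : ∀ {e e′} → e ∈ s ∷ M → e′ ∈ s ∷ M → e ≢ e′ → ∀ j → J j ≡ true → Differ (λ e → sv e j) e e′
        diff′ (here refl) (here refl) ne j Jj = contradiction refl ne
        diff′ (here refl) (there e′∈) ne j Jj = disagree (All.lookup fresh e′∈) j Jj
        diff′ (there e∈) (here refl) ne j Jj with disagree (All.lookup fresh e∈) j Jj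
        ... | c , neq = c , neq ∘ ≡.sym
        diff′ (there e∈) (there e′∈) ne j Jj = diff e∈ e′∈ ne j Jj

    -- The vertices of a maximal matching meet every hyperedge. So either the matching is long
    -- enough for `matching-shatters`, or its vectors form a short cover.
    shatters-or-covered : (S : List E) (J : Fin R → Bool) → (∃ λ c → Shatters S sv J c) ⊎
      (∃ λ X → (∀ j → length (X j) ≤ matchingBound N R) × (∀ {e} → e ∈ S → Covered J X e))
    shatters-or-covered S J with any? (λ j → J j ≟ᵇ true)
    -- For empty `J` nothing is prescribed, so any element of `S` shatters; an empty `S` has the
    -- empty cover.
    shatters-or-covered [] J | no _ = inj₂ ((λ _ → []) , (λ _ → z≤n) , λ ())
    shatters-or-covered (s ∷ S) J | no ∄j = inj₁ ((λ _ → d) , λ π → s , here refl , λ j Jj → contradiction (j , Jj) ∄j)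
    ... | yes ∃j with maximal-matching J ∃j S
    ...   | M , uniq , ⊆S , diff , max with matchingBound N R <? length M
    ...     | yes large = let c , sh = matching-shatters sv J M uniq diff large
                          in inj₁ (c , λ π → let e , e∈ , ok = sh π in e , ⊆S e∈ , ok)
    ...     | no ¬large = inj₂ ((λ j → map (λ e → sv e j) M) ,
      (λ j → ≤-trans (≤-reflexive (length-map _ M)) (≮⇒≥ ¬large)) , λ e∈ → covered M (max e∈))
      where
      covered : ∀ {e} M → Any (Agree J e) M → Covered J (λ j → map (λ e → sv e j) M) e
      covered (_ ∷ M) (here (j , Jj , same)) = j , Jj , here same
      covered (_ ∷ M) (there a) with covered M a
      ... | j , Jj , at = j , Jj , there at

    among? : ∀ (X : Fin R → List (Fin N → Bool)) e j → Dec (Any (λ x → sv e j ≗ x) (X j))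
    among? X e j = Any.any? (λ x → all? λ c → sv e j c ≟ᵇ x c) (X j)

    -- X j collects the covers of all J that are not shattered; if the set J of classes in which e lies
    -- outside X were not shattered either, e would lie in its cover.
    outside-shattered : (S : List E) → ∃ λ (X : Fin R → List (Fin N → Bool)) →
      (∀ j → length (X j) ≤ 2 ^ R * matchingBound N R) ×
      (∀ {e} → e ∈ S → ∃ λ c → Shatters S sv (λ j → not (does (among? X e j))) c)
    outside-shattered S = X , len , sh
      where
      part-of : ∀ {J : Fin R → Bool} → (∃ λ c → Shatters S sv J c) ⊎
        (∃ λ X → (∀ j → length (X j) ≤ matchingBound N R) × (∀ {e} → e ∈ S → Covered J X e)) →
        Fin R → List (Fin N → Bool)
      part-of (inj₁ _) j = []
      part-of (inj₂ (X , _)) j = X j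

      part-length : ∀ {J : Fin R → Bool} o j → length (part-of {J} o j) ≤ matchingBound N R
      part-length (inj₁ _) j = z≤n
      part-length (inj₂ (_ , bound , _)) j = bound j

      outcome : ∀ z → _
      outcome z = shatters-or-covered S (bit {R} z)

      X : Fin R → List (Fin N → Bool)
      X j = concat (tabulate {n = 2 ^ R} (λ z → part-of (outcome z) j))

      concat-length : ∀ {A : Set} {b} n (f : Fin n → List A) → (∀ i → length (f i) ≤ b) → length (concat (tabulate f)) ≤ n * b
      concat-length zero    f le = z≤n
      concat-length (suc n) f le = ≤-trans (≤-reflexive (length-++ (f zero))) (+-mono-≤ (le zero) (concat-length n (f ∘ suc) (le ∘ suc)))

      len : ∀ j → length (X j) ≤ 2 ^ R * matchingBound N R
      len j = concat-length (2 ^ R) _ (λ z → part-length (outcome z) j)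

      sh : ∀ {e} → e ∈ S → ∃ λ c → Shatters S sv (λ j → not (does (among? X e j))) c
      sh {e} e∈ = go (outcome (code J)) refl
        where
        J : Fin R → Bool
        J j = not (does (among? X e j))

        go : ∀ o → o ≡ outcome (code J) → ∃ λ c → Shatters S sv J c
        go (inj₁ (c , sh)) _ = c , λ π → let e , e∈ , ok = sh π in e , e∈ , λ j Jj → ok j (trans (bit-code J j) Jj)
        go (inj₂ (X′ , _ , cov)) eq with cov e∈
        ... | j , in-J , at = contradiction (trans (≡.sym (bit-code J j)) in-J)
          (λ Jj → case trans (≡.sym (cong not (dec-true (among? X e j) here-in-X))) Jj of λ ())
          where
          here-in-X : Any (λ x → sv e j ≗ x) (X j)
          here-in-X = Any.concat⁺ (Any.tabulate⁺ (code J) (subst (λ o → Any (λ x → sv e j ≗ x) (part-of o j)) eq at))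

-- Numerical estimates

n<2^n : ∀ n → n < 2 ^ n
n<2^n zero    = s≤s z≤n
n<2^n (suc n) = ≤-trans (s≤s (n<2^n n)) (≤-trans (+-monoˡ-≤ (2 ^ n) (m^n>0 2 n)) (≤-reflexive (cong (2 ^ n +_) (≡.sym (+-identityʳ (2 ^ n))))))

^-distribʳ-* : ∀ e m n → (m * n) ^ e ≡ m ^ e * n ^ e
^-distribʳ-* zero    m n = refl
^-distribʳ-* (suc e) m n = trans (cong (m * n *_) (^-distribʳ-* e m n))
  (solve 4 (λ a b c d → a :* b :* (c :* d) := a :* c :* (b :* d)) refl m n (m ^ e) (n ^ e))

-- `y` is taken as a power of two, so that the left side is bounded by a power of two as well and
-- only exponents are compared. With `x = w + w` the right exponent is `2 ^ w * 2 ^ w`, while the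
-- left one is at most `w * w + w`.
exponential-dominates : ∀ C E d → ∃ λ y → 1 ≤ y × C * (E * y + 2) ^ d ≤ 2 ^ y
exponential-dominates C E d = y , m^n>0 2 x , (begin
  C * (E * y + 2) ^ d                    ≤⟨ *-mono-≤ (<⇒≤ (n<2^n C)) (^-monoˡ-≤ d base) ⟩
  2 ^ C * (2 ^ (E + 2 + x)) ^ d          ≡⟨ cong (2 ^ C *_) (^-*-assoc 2 (E + 2 + x) d) ⟩
  2 ^ C * 2 ^ ((E + 2 + x) * d)          ≡⟨ ^-distribˡ-+-* 2 C ((E + 2 + x) * d) ⟨
  2 ^ (C + (E + 2 + x) * d)              ≤⟨ ^-monoʳ-≤ 2 exponent ⟩
  2 ^ y                                  ∎)
  where
  open ≤-Reasoning
  g = C + d * (E + 2)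
  w = 2 * d + g
  x = w + w
  y = 2 ^ x
  base : E * y + 2 ≤ 2 ^ (E + 2 + x)
  base = begin
    E * y + 2          ≤⟨ +-monoʳ-≤ (E * y) (*-monoʳ-≤ 2 (m^n>0 2 x)) ⟩
    E * y + 2 * y      ≡⟨ *-distribʳ-+ y E 2 ⟨
    (E + 2) * y        ≤⟨ *-monoˡ-≤ y (<⇒≤ (n<2^n (E + 2))) ⟩
    2 ^ (E + 2) * y    ≡⟨ ^-distribˡ-+-* 2 (E + 2) x ⟨
    2 ^ (E + 2 + x)    ∎
  exponent : C + (E + 2 + x) * d ≤ y
  exponent = begin
    C + (E + 2 + (w + w)) * d    ≡⟨ solve 4 (λ C E d w → C :+ (E :+ con 2 :+ (w :+ w)) :* d := w :* (con 2 :* d) :+ (C :+ d :* (E :+ con 2))) refl C E d w ⟩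
    w * (2 * d) + g              ≤⟨ +-mono-≤ (*-monoʳ-≤ w (m≤m+n (2 * d) g)) (m≤n+m g (2 * d)) ⟩
    w * w + w                    ≤⟨ m≤m+n _ (suc w) ⟩
    w * w + w + suc w            ≡⟨ solve 1 (λ w → w :* w :+ w :+ (con 1 :+ w) := (con 1 :+ w) :* (con 1 :+ w)) refl w ⟩
    suc w * suc w                ≤⟨ *-mono-≤ (n<2^n w) (n<2^n w) ⟩
    2 ^ w * 2 ^ w                ≡⟨ ^-distribˡ-+-* 2 w w ⟨
    2 ^ (w + w)                  ∎

-- Passing from `R` to `R + 1` costs a factor of at most `(N + 2) ^ (R + 1)`, and `R * R + (R + 1)`
-- is at most the square of `R + 1`. What matters is that the exponent is independent of `N`.
matchingBound-poly : ∀ N R → matchingBound N R ≤ (N + 2) ^ (R * R)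
matchingBound-poly N zero    = ≤-refl
matchingBound-poly N (suc R) = begin
  N ^ R * (B * suc N) + B                      ≡⟨ solve 3 (λ p b n → p :* (b :* n) :+ b := b :* (p :* n :+ con 1)) refl (N ^ R) B (suc N) ⟩
  B * (N ^ R * suc N + 1)                      ≤⟨ *-mono-≤ (matchingBound-poly N R) (+-mono-≤ (*-monoˡ-≤ (suc N) (^-monoˡ-≤ R (m≤m+n N 2))) (subst (λ t → 1 ≤ t ^ R) (+-comm 2 N) (m^n>0 (2 + N) R))) ⟩
  q ^ (R * R) * (q ^ R * suc N + q ^ R)        ≡⟨ cong (q ^ (R * R) *_) (solve 2 (λ n p → p :* (con 1 :+ n) :+ p := (n :+ con 2) :* p) refl N (q ^ R)) ⟩
  q ^ (R * R) * q ^ suc R                      ≡⟨ ^-distribˡ-+-* q (R * R) (suc R) ⟨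
  q ^ (R * R + suc R)                          ≤⟨ subst (λ t → t ^ (R * R + suc R) ≤ t ^ (suc R * suc R)) (+-comm 2 N) (^-monoʳ-≤ (2 + N) le) ⟩
  q ^ (suc R * suc R)                          ∎
  where
  open ≤-Reasoning
  B = matchingBound N R
  q = N + 2
  le : R * R + suc R ≤ suc R * suc R
  le = ≤-trans (m≤m+n _ R) (≤-reflexive (solve 1 (λ r → r :* r :+ (con 1 :+ r) :+ r := (con 1 :+ r) :* (con 1 :+ r)) refl R))

-- Bernoulli's inequality for `1 + 1/a`, without denominators.
bernoulli⁺ : ∀ a n → a ^ n * (a + n) ≤ suc a ^ n * a
bernoulli⁺ a zero    = ≤-reflexive (cong (1 *_) (+-identityʳ a))
bernoulli⁺ a (suc n) = begin
  a * a ^ n * (a + suc n)       ≤⟨ m≤m+n _ (a ^ n * n) ⟩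
  a * a ^ n * (a + suc n) + a ^ n * n ≡⟨ solve 3 (λ a n p → a :* p :* (a :+ (con 1 :+ n)) :+ p :* n := (con 1 :+ a) :* (p :* (a :+ n))) refl a n (a ^ n) ⟩
  suc a * (a ^ n * (a + n))     ≤⟨ *-monoʳ-≤ (suc a) (bernoulli⁺ a n) ⟩
  suc a * (suc a ^ n * a)       ≡⟨ *-assoc (suc a) (suc a ^ n) a ⟨
  suc a * suc a ^ n * a         ∎
  where open ≤-Reasoning

-- Bernoulli's inequality for `1 - 1/(a + 1)`, multiplied by `(a + 1)^(n + 1)`.
bernoulli⁻ : ∀ a n → suc a ^ suc n ≤ a ^ n * suc a + n * suc a ^ n
bernoulli⁻ a zero    = ≤-reflexive (solve 1 (λ a → (con 1 :+ a) :* con 1 := con 1 :* (con 1 :+ a) :+ con 0) refl a)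
bernoulli⁻ a (suc n) = begin
  suc a * (suc a * P)                              ≡⟨ solve 2 (λ a p → (con 1 :+ a) :* ((con 1 :+ a) :* p) := a :* ((con 1 :+ a) :* p) :+ (con 1 :+ a) :* p) refl a P ⟩
  a * (suc a * P) + suc a * P                      ≤⟨ +-monoˡ-≤ (suc a * P) (*-monoʳ-≤ a (bernoulli⁻ a n)) ⟩
  a * (a ^ n * suc a + n * P) + suc a * P          ≤⟨ m≤m+n _ (n * P) ⟩
  a * (a ^ n * suc a + n * P) + suc a * P + n * P  ≡⟨ solve 4 (λ a n p q → a :* (q :* (con 1 :+ a) :+ n :* p) :+ (con 1 :+ a) :* p :+ n :* p := a :* q :* (con 1 :+ a) :+ (con 1 :+ n) :* ((con 1 :+ a) :* p)) refl a n P (a ^ n) ⟩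
  a * a ^ n * suc a + suc n * (suc a * P)          ∎
  where
  open ≤-Reasoning
  P = suc a ^ n

double-power : ∀ a → 1 ≤ a → 2 * a ^ a ≤ suc a ^ a
double-power (suc a′) _ = *-cancelʳ-≤ _ _ (suc a′) (≤-trans (≤-reflexive
    (solve 2 (λ a p → con 2 :* p :* a := p :* (a :+ a)) refl (suc a′) (suc a′ ^ suc a′))) (bernoulli⁺ (suc a′) (suc a′)))

-- With b = c in the ball estimate, the base (2c+1)^(2c) / (c^(c-1) (c+1)^(c+1)) is smaller than 2^(2c).
base-gap : ∀ c₀ → let c = suc c₀ in (c + suc c) ^ (2 * c) < c ^ c₀ * suc c ^ suc c * 2 ^ (2 * c)
base-gap c₀ = *-cancelˡ-< c _ _ (begin-strict
  c * (c + suc c) ^ (2 * c)              ≡⟨ cong (c *_) (≡.sym (^-*-assoc (c + suc c) 2 c)) ⟩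
  c * ((c + suc c) ^ 2) ^ c              ≡⟨ cong (λ t → c * t ^ c) square ⟩
  c * P                                  <⟨ key ⟩
  a ^ c * suc c                          ≡⟨ cong (_* suc c) (trans (^-distribʳ-* c (2 ^ 2) (c * suc c)) (cong₂ _*_ (^-*-assoc 2 2 c) (^-distribʳ-* c c (suc c)))) ⟩
  2 ^ (2 * c) * (c ^ c * suc c ^ c) * suc c ≡⟨ solve 4 (λ t c p q → t :* (c :* p :* q) :* (con 1 :+ c) := c :* (p :* ((con 1 :+ c) :* q) :* t)) refl (2 ^ (2 * c)) c (c ^ c₀) (suc c ^ c) ⟩
  c * (c ^ c₀ * suc c ^ suc c * 2 ^ (2 * c)) ∎)
  where
  open ≤-Reasoning
  c = suc c₀
  a = 4 * (c * suc c)
  P = suc a ^ c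
  square : (c + suc c) ^ 2 ≡ suc a
  square = solve 1 (λ c → (c :+ (con 1 :+ c)) :* ((c :+ (con 1 :+ c)) :* con 1) := con 1 :+ con 4 :* (c :* (con 1 :+ c))) refl c
  -- As `(2c + 1)^2 = a + 1`, what remains is `(1 + 1/a)^c < 1 + 1/c`. By `bernoulli⁻` it follows
  -- from `c * (c + 1) < a + 1`.
  key : c * P < a ^ c * suc c
  key = *-cancelˡ-< (suc a) _ _ (+-cancelʳ-< (c * suc c * P) _ _ (begin-strict
    suc a * (c * P) + c * suc c * P     <⟨ +-monoʳ-< (suc a * (c * P)) (*-monoˡ-< P {{>-nonZero (m^n>0 (suc a) c)}} (s≤s (m≤m+n (c * suc c) _))) ⟩
    suc a * (c * P) + suc a * P         ≡⟨ solve 3 (λ a c p → a :* (c :* p) :+ a :* p := (con 1 :+ c) :* (a :* p)) refl (suc a) c P ⟩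
    suc c * (suc a * P)                 ≤⟨ *-monoʳ-≤ (suc c) (bernoulli⁻ a c) ⟩
    suc c * (a ^ c * suc a + c * P)     ≡⟨ solve 4 (λ a c p q → (con 1 :+ c) :* (q :* a :+ c :* p) := a :* (q :* (con 1 :+ c)) :+ c :* (con 1 :+ c) :* p) refl (suc a) c P (a ^ c) ⟩
    suc a * (a ^ c * suc c) + c * suc c * P ∎))

-- The strict inequality `base-gap` between integers leaves a factor of at least `(α + 1) / α`,
-- whose power with exponent `α * y` is at least `2 ^ y`; `y` is chosen so that this absorbs the
-- polynomial.
ball-small : ∀ c₀ C d → let c = suc c₀ in ∃ λ N₁ → 1 ≤ N₁ ×
  C * (2 * c * N₁ + 2) ^ d * (c + suc c) ^ (2 * c * N₁) ≤ c ^ (c₀ * N₁) * suc c ^ (suc c * N₁) * 2 ^ (2 * c * N₁)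
ball-small c₀ C d = N₁ , *-mono-≤ 1≤α 1≤y , (begin
  C * (2 * c * N₁ + 2) ^ d * (c + suc c) ^ (2 * c * N₁)
    ≡⟨ cong₂ (λ s t → C * (s + 2) ^ d * t) (≡.sym (*-assoc (2 * c) α y)) (≡.sym (^-*-assoc (c + suc c) (2 * c) N₁)) ⟩
  C * (2 * c * α * y + 2) ^ d * α ^ N₁     ≤⟨ *-monoˡ-≤ (α ^ N₁) dominated ⟩
  2 ^ y * α ^ (α * y)                      ≡⟨ cong (2 ^ y *_) (^-*-assoc α α y) ⟨
  2 ^ y * (α ^ α) ^ y                      ≡⟨ ^-distribʳ-* y 2 (α ^ α) ⟨
  (2 * α ^ α) ^ y                          ≤⟨ ^-monoˡ-≤ y (double-power α 1≤α) ⟩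
  (suc α ^ α) ^ y                          ≡⟨ ^-*-assoc (suc α) α y ⟩
  suc α ^ N₁                               ≤⟨ ^-monoˡ-≤ N₁ (base-gap c₀) ⟩
  (c ^ c₀ * suc c ^ suc c * 2 ^ (2 * c)) ^ N₁
    ≡⟨ trans (^-distribʳ-* N₁ (c ^ c₀ * suc c ^ suc c) (2 ^ (2 * c))) (cong₂ _*_ (trans (^-distribʳ-* N₁ (c ^ c₀) (suc c ^ suc c)) (cong₂ _*_ (^-*-assoc c c₀ N₁) (^-*-assoc (suc c) (suc c) N₁))) (^-*-assoc 2 (2 * c) N₁)) ⟩
  c ^ (c₀ * N₁) * suc c ^ (suc c * N₁) * 2 ^ (2 * c * N₁) ∎)
  where
  open ≤-Reasoning
  c = suc c₀
  α = (c + suc c) ^ (2 * c)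
  chosen = exponential-dominates C (2 * c * α) d
  y = proj₁ chosen
  1≤y = proj₁ (proj₂ chosen)
  dominated = proj₂ (proj₂ chosen)
  N₁ = α * y
  1≤α : 1 ≤ α
  1≤α = m^n>0 (c + suc c) (2 * c)

-- Multipartite patterns

-- A multipartite graph; only the links from a vertex to vertices of smaller part are relevant.
record Pattern : Set where
  field
    size : ℕ
    part : Fin size → ℕ
    link : Fin size → Fin size → Bool

open Pattern

onPart : ∀ {n} → (Fin n → ℕ) → ℕ → Fin n → ℕ
onPart p i j = 𝟙 (does (p j ℕ.≟ i))

-- `θ` is constrained only on the parts below `r`, so that one and the same `F` can be kept
-- throughout an induction on `r`.
record Copy (r : ℕ) (F F̂ : Pattern) (χ : Fin (size F̂) → Bool) : Set where
  field
    θ         : Fin (size F) → Fin (size F̂)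
    selected  : ∀ x → part F x < r → χ (θ x) ≡ true
    samePart  : ∀ x → part F x < r → part F̂ (θ x) ≡ part F x
    injective : ∀ x y → part F x < r → part F y < r → θ x ≡ θ y → x ≡ y
    linked    : ∀ x y → part F x < r → part F y < part F x → link F̂ (θ x) (θ y) ≡ link F x y

-- Every selection of a 1/e-fraction of the weight of each of the parts 0, …, r-1 contains F.
record DenseHost (r e : ℕ) (F : Pattern) : Set where
  field
    host     : Pattern
    weight   : Fin (size host) → ℕ
    Ω        : ℕ
    1≤Ω      : 1 ≤ Ω
    unused   : ∀ j → r ≤ part host j → weight j ≡ 0
    balanced : ∀ i → i < r → sum (λ j → onPart (part host) i j * weight j) ≡ Ω
    total    : sum weight ≤ r * Ω
    find     : ∀ χ → (∀ i → i < r → Ω ≤ e * sum (λ j → onPart (part host) i j * (𝟙 (χ j) * weight j))) → Copy r F host χ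

-- The row wanted on `F` is transported to the image of `θ` and set to `false` elsewhere, which
-- turns it into a pattern that a shattering family realises.
extend-along : ∀ {m n} {P : Fin m → Set} → (∀ x → Dec (P x)) → (θ : Fin m → Fin n) →
  (∀ x y → P x → P y → θ x ≡ θ y → x ≡ y) → (v : Fin m → Bool) → ∃ λ (π : Fin n → Bool) → ∀ x → P x → π (θ x) ≡ v x
extend-along {m} {n} {P} P? θ inj v = (λ j → value (preimage? j)) , λ x Px → value-θ x Px (preimage? (θ x))
  where
  preimage? : ∀ j → Dec (∃ λ x → P x × θ x ≡ j)
  preimage? j = any? λ x → P? x ×-dec (θ x ≟ j)
  value : ∀ {j} → Dec (∃ λ x → P x × θ x ≡ j) → Bool
  value (yes (x , _)) = v x
  value (no _)        = false
  value-θ : ∀ x → P x → (d : Dec (∃ λ y → P y × θ y ≡ θ x)) → value d ≡ v x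
  value-θ x Px (yes (y , Py , eq)) = cong v (inj y x Py Px eq)
  value-θ x Px (no ∄)              = contradiction (x , Px , refl) ∄

Any-≤ : ∀ {A : Set} {P : A → Set} (f : A → ℕ) {xs : List A} → (∀ x → P x → 1 ≤ f x) → Any P xs →
  1 ≤ sum (λ l → f (lookup xs l))
Any-≤ f {xs} P⇒ a = ≤-trans (P⇒ _ (Any.lookup-index a)) (term≤sum (λ l → f (lookup xs l)) (Any.index a))

𝟙-mono : ∀ b {n} → (b ≡ true → 1 ≤ n) → 𝟙 b ≤ n
𝟙-mono true  h = h refl
𝟙-mono false h = z≤n

-- Part `r` is added to a host for density `1 / (2e)`. Every old vertex becomes `N` clones, and the
-- new part has `M` fibres, each containing every possible neighbourhood among the `L` clones. A
-- dense selection keeps many clones of enough old vertices, and enough of the fibres shatter a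
-- common transversal of these.
module DenseStep (r e₀ : ℕ) (F : Pattern) (D : DenseHost r (2 * suc e₀) F) where

  open DenseHost D
  private
    e T T̂ : ℕ
    e = suc e₀
    T = size F
    T̂ = size host

    chosen : _
    chosen = exponential-dominates (2 * e * T̂) 1 (T̂ * T̂)

    N′ N L Y M K : ℕ
    -- `N′` clones must survive in a usable class. With `N = 2 * e * N′`, the other classes account
    -- for at most half of the density `1 / e`. There are `Y` transversals, and `M` is large enough
    -- for more than `Y * T` fibres to succeed.
    N′ = proj₁ chosen
    N = 2 * e * N′
    L = T̂ * N
    Y = N′ ^ T̂
    M = 2 * e * suc (Y * T)
    K = M * 2 ^ L

    1≤N′ : 1 ≤ N′
    1≤N′ = proj₁ (proj₂ chosen)

    N′-large : 2 * e * T̂ * matchingBound N′ T̂ ≤ 2 ^ N′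
    N′-large = ≤-trans (*-monoʳ-≤ (2 * e * T̂) (≤-trans (matchingBound-poly N′ T̂)
      (≤-reflexive (cong (λ t → (t + 2) ^ (T̂ * T̂)) (≡.sym (*-identityˡ N′)))))) (proj₂ (proj₂ chosen))

    Kind : Set
    Kind = (Fin T̂ × Fin N) ⊎ (Fin M × Fin (2 ^ L))

    kind : Fin (L + K) → Kind
    kind w = [ inj₁ ∘ remQuot N , inj₂ ∘ remQuot (2 ^ L) ]′ (splitAt L w)

    old : Fin T̂ → Fin N → Fin (L + K)
    old j c = combine j c ↑ˡ K

    new : Fin M → Fin (2 ^ L) → Fin (L + K)
    new t z = L ↑ʳ combine t z

    kind-old : ∀ j c → kind (old j c) ≡ inj₁ (j , c)
    kind-old j c = trans (cong [ inj₁ ∘ remQuot N , inj₂ ∘ remQuot (2 ^ L) ]′ (splitAt-↑ˡ L (combine j c) K))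
      (cong inj₁ (remQuot-combine j c))

    kind-new : ∀ t z → kind (new t z) ≡ inj₂ (t , z)
    kind-new t z = trans (cong [ inj₁ ∘ remQuot N , inj₂ ∘ remQuot (2 ^ L) ]′ (splitAt-↑ʳ L K (combine t z)))
      (cong inj₂ (remQuot-combine t z))

    sum-kinds : ∀ (f : Fin (L + K) → ℕ) →
      sum f ≡ sum (λ j → sum (λ c → f (old j c))) + sum (λ t → sum (λ z → f (new t z)))
    sum-kinds f = trans (sum-join L K f)
      (cong₂ _+_ (sum-combine T̂ N (λ i → f (i ↑ˡ K))) (sum-combine M (2 ^ L) (λ i → f (L ↑ʳ i))))

    part′ : Kind → ℕ
    part′ (inj₁ (j , c)) = part host j
    part′ (inj₂ _)       = r

    link′ : Kind → Kind → Bool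
    link′ (inj₁ (j , _)) (inj₁ (j′ , _)) = link host j j′
    link′ (inj₂ (_ , z)) (inj₁ (j , c))  = bit {L} z (combine j c)
    link′ _              (inj₂ _)        = false

    -- Scaled so that every part, old or new, has the same total `Ω * N * K`.
    weight′ : Kind → ℕ
    weight′ (inj₁ (j , c)) = weight j * K
    weight′ (inj₂ _)       = Ω * N

    host′ : Pattern
    host′ = record { size = L + K ; part = part′ ∘ kind ; link = λ w w′ → link′ (kind w) (kind w′) }

    Ω′ : ℕ
    Ω′ = Ω * N * K

    1≤N : 1 ≤ N
    1≤N = *-mono-≤ {1} {2 * e} {1} {N′} (s≤s z≤n) 1≤N′

    1≤K : 1 ≤ K
    1≤K = *-mono-≤ {1} {M} {1} {2 ^ L} (s≤s z≤n) (m^n>0 2 L)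

    on : ∀ i (k : Kind) → ℕ
    on i k = 𝟙 (does (part′ k ℕ.≟ i))

    sum-on : ∀ i (s : Fin (L + K) → ℕ) →
      sum (λ w → onPart (part host′) i w * (s w * weight′ (kind w))) ≡
      K * sum (λ j → onPart (part host) i j * (weight j * sum (λ c → s (old j c)))) +
      𝟙 (does (r ℕ.≟ i)) * (Ω * N * sum (λ t → sum (λ z → s (new t z))))
    sum-on i s = trans (sum-kinds _) (cong₂ _+_
      (trans (sum-cong (λ j → trans (sum-cong (λ c → trans (cong (λ k → on i k * (s (old j c) * weight′ k)) (kind-old j c))
          (solve 4 (λ o s w k → o :* (s :* (w :* k)) := k :* (o :* w) :* s) refl (onPart (part host) i j) (s (old j c)) (weight j) K)))
        (trans (≡.sym (sum-*ˡ (K * (onPart (part host) i j * weight j)) (λ c → s (old j c))))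
          (solve 4 (λ o s w k → k :* (o :* w) :* s := k :* (o :* (w :* s))) refl (onPart (part host) i j) (sum (λ c → s (old j c))) (weight j) K))))
        (≡.sym (sum-*ˡ K _)))
      (trans (sum-cong (λ t → trans (sum-cong (λ z → trans (cong (λ k → on i k * (s (new t z) * weight′ k)) (kind-new t z))
          (solve 3 (λ o s w → o :* (s :* w) := o :* w :* s) refl (𝟙 (does (r ℕ.≟ i))) (s (new t z)) (Ω * N))))
        (≡.sym (sum-*ˡ (𝟙 (does (r ℕ.≟ i)) * (Ω * N)) (λ z → s (new t z))))))
        (trans (≡.sym (sum-*ˡ (𝟙 (does (r ℕ.≟ i)) * (Ω * N)) (λ t → sum (λ z → s (new t z))))) (*-assoc (𝟙 (does (r ℕ.≟ i))) (Ω * N) _))))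

    sum-on-old : ∀ i → i < r → (s : Fin (L + K) → ℕ) →
      sum (λ w → onPart (part host′) i w * (s w * weight′ (kind w))) ≡
      K * sum (λ j → onPart (part host) i j * (weight j * sum (λ c → s (old j c))))
    sum-on-old i i<r s = trans (sum-on i s) (trans (cong (λ b → K * sum (λ j → onPart (part host) i j * (weight j * sum (λ c → s (old j c)))) + 𝟙 b * (Ω * N * sum (λ t → sum (λ z → s (new t z))))) (dec-false (r ℕ.≟ i) (>⇒≢ i<r))) (+-identityʳ _))

    sum-on-new : ∀ (s : Fin (L + K) → ℕ) →
      sum (λ w → onPart (part host′) r w * (s w * weight′ (kind w))) ≡ Ω * N * sum (λ t → sum (λ z → s (new t z)))
    sum-on-new s = trans (sum-on r s) (cong₂ _+_
      (trans (cong (K *_) (trans (sum-cong vanish) (sum-zero T̂))) (*-zeroʳ K))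
      (trans (cong (λ b → 𝟙 b * (Ω * N * sum (λ t → sum (λ z → s (new t z))))) (dec-true (r ℕ.≟ r) refl)) (*-identityˡ _)))
      where
      vanish : ∀ j → onPart (part host) r j * (weight j * sum (λ c → s (old j c))) ≡ 0
      vanish j with part host j ℕ.≟ r
      ... | no  p≢r = cong (λ b → 𝟙 b * (weight j * sum (λ c → s (old j c)))) (dec-false (part host j ℕ.≟ r) p≢r)
      ... | yes p≡r = trans (cong (λ w → onPart (part host) r j * (w * sum (λ c → s (old j c)))) (unused j (≤-reflexive (≡.sym p≡r)))) (*-zeroʳ (onPart (part host) r j))

    ones : ∀ n → sum {n} (λ _ → 1) ≡ n
    ones n = trans (sum-const n 1) (*-identityʳ n)

    unit-weight : ∀ i → sum (λ w → onPart (part host′) i w * weight′ (kind w)) ≡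
      sum (λ w → onPart (part host′) i w * (1 * weight′ (kind w)))
    unit-weight i = sum-cong (λ w → cong (onPart (part host′) i w *_) (≡.sym (*-identityˡ _)))

    balanced′ : ∀ i → i < suc r → sum (λ w → onPart (part host′) i w * weight′ (kind w)) ≡ Ω′
    balanced′ i i<1+r with m≤n⇒m<n∨m≡n (≤-pred i<1+r)
    ... | inj₁ i<r = trans (unit-weight i) (trans (sum-on-old i i<r (λ _ → 1)) (begin
      K * sum (λ j → onPart (part host) i j * (weight j * sum {N} (λ _ → 1)))
        ≡⟨ cong (K *_) (sum-cong (λ j → trans (cong (λ n → onPart (part host) i j * (weight j * n)) (ones N))
             (solve 3 (λ o w n → o :* (w :* n) := n :* (o :* w)) refl (onPart (part host) i j) (weight j) N))) ⟩
      K * sum (λ j → N * (onPart (part host) i j * weight j))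
        ≡⟨ cong (K *_) (trans (≡.sym (sum-*ˡ N _)) (cong (N *_) (balanced i i<r))) ⟩
      K * (N * Ω)
        ≡⟨ solve 3 (λ k n o → k :* (n :* o) := o :* n :* k) refl K N Ω ⟩
      Ω * N * K ∎))
      where open ≡-Reasoning
    ... | inj₂ refl = trans (unit-weight r) (trans (sum-on-new (λ _ → 1))
      (cong (Ω * N *_) (trans (sum-cong (λ _ → ones (2 ^ L))) (sum-const M (2 ^ L)))))

    total′ : sum (λ w → weight′ (kind w)) ≤ suc r * Ω′
    total′ = begin
      sum (λ w → weight′ (kind w))
        ≡⟨ sum-kinds _ ⟩
      sum (λ j → sum (λ c → weight′ (kind (old j c)))) + sum (λ t → sum (λ z → weight′ (kind (new t z))))
        ≡⟨ cong₂ _+_ (sum-cong (λ j → trans (trans (sum-cong (λ c → cong weight′ (kind-old j c))) (sum-const N _))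
              (solve 3 (λ n w k → n :* (w :* k) := n :* k :* w) refl N (weight j) K)))
             (trans (sum-cong (λ t → trans (sum-cong (λ z → cong weight′ (kind-new t z))) (sum-const (2 ^ L) (Ω * N)))) (sum-const M _)) ⟩
      sum (λ j → N * K * weight j) + M * (2 ^ L * (Ω * N))
        ≡⟨ cong₂ _+_ (≡.sym (sum-*ˡ (N * K) weight)) (solve 3 (λ m l o → m :* (l :* o) := o :* (m :* l)) refl M (2 ^ L) (Ω * N)) ⟩
      N * K * sum weight + Ω′
        ≤⟨ +-monoˡ-≤ Ω′ (*-monoʳ-≤ (N * K) total) ⟩
      N * K * (r * Ω) + Ω′
        ≡⟨ solve 4 (λ n k r o → n :* k :* (r :* o) :+ o :* n :* k := (con 1 :+ r) :* (o :* n :* k)) refl N K r Ω ⟩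
      suc r * Ω′ ∎
      where open ≤-Reasoning

    unused′ : ∀ w → suc r ≤ part host′ w → weight′ (kind w) ≡ 0
    unused′ w = go (kind w)
      where
      go : ∀ k → suc r ≤ part′ k → weight′ k ≡ 0
      go (inj₁ (j , c)) le = cong (_* K) (unused j (<⇒≤ le))
      go (inj₂ _)       le = contradiction le 1+n≰n

    module Find (χ : Fin (L + K) → Bool)
      (dense : ∀ i → i < suc r → Ω′ ≤ e * sum (λ w → onPart (part host′) i w * (𝟙 (χ w) * weight′ (kind w)))) where

      cnt : Fin T̂ → ℕ
      cnt j = sum (λ c → 𝟙 (χ (old j c)))

      good : Fin T̂ → Bool
      good j = does (N′ ≤? cnt j)

      cnt≤ : ∀ j → cnt j ≤ N * 𝟙 (good j) + N′
      cnt≤ j with N′ ≤? cnt j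
      ... | yes N′≤ = ≤-trans (≤-trans (sum-mono (λ c → 𝟙≤1 (χ (old j c)))) (≤-reflexive (ones N)))
            (≤-trans (≤-reflexive (≡.sym (trans (cong (λ b → N * 𝟙 b) (dec-true (N′ ≤? cnt j) N′≤)) (*-identityʳ N)))) (m≤m+n _ N′))
      ... | no  N′≰ = ≤-trans (<⇒≤ (≰⇒> N′≰)) (m≤n+m N′ _)

      -- Classes retaining fewer than `N′` clones contribute at most `1 / (2e)` of the weight of a
      -- part, so the good ones supply the other half of `1 / e`.
      old-dense : ∀ i → i < r → Ω ≤ 2 * e * sum (λ j → onPart (part host) i j * (𝟙 (good j) * weight j))
      old-dense i i<r = *-cancelˡ-≤ (N * K) {{>-nonZero (*-mono-≤ 1≤N 1≤K)}} (+-cancelʳ-≤ (N * K * Ω) _ _ (begin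
        N * K * Ω + N * K * Ω      ≡⟨ solve 3 (λ n k o → n :* k :* o :+ n :* k :* o := con 2 :* (o :* n :* k)) refl N K Ω ⟩
        2 * Ω′                     ≤⟨ *-monoʳ-≤ 2 (dense i (m<n⇒m<1+n i<r)) ⟩
        2 * (e * sum (λ w → onPart (part host′) i w * (𝟙 (χ w) * weight′ (kind w))))
          ≡⟨ cong (λ s → 2 * (e * s)) (sum-on-old i i<r (𝟙 ∘ χ)) ⟩
        2 * (e * (K * sum (λ j → o j * (weight j * cnt j))))
          ≤⟨ *-monoʳ-≤ 2 (*-monoʳ-≤ e (*-monoʳ-≤ K (sum-mono (λ j → *-monoʳ-≤ (o j) (*-monoʳ-≤ (weight j) (cnt≤ j)))))) ⟩
        2 * (e * (K * sum (λ j → o j * (weight j * (N * 𝟙 (good j) + N′)))))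
          ≡⟨ cong (λ s → 2 * (e * (K * s))) (trans (sum-cong (λ j →
               solve 5 (λ o w n g n′ → o :* (w :* (n :* g :+ n′)) := n :* (o :* (g :* w)) :+ n′ :* (o :* w)) refl (o j) (weight j) N (𝟙 (good j)) N′))
               (trans (sum-+ _ _) (cong₂ _+_ (≡.sym (sum-*ˡ N _)) (≡.sym (sum-*ˡ N′ _))))) ⟩
        2 * (e * (K * (N * A + N′ * sum (λ j → o j * weight j))))
          ≡⟨ cong (λ s → 2 * (e * (K * (N * A + N′ * s)))) (balanced i i<r) ⟩
        2 * (e * (K * (N * A + N′ * Ω)))
          ≡⟨ solve 5 (λ e k n′ a o → con 2 :* (e :* (k :* (con 2 :* e :* n′ :* a :+ n′ :* o))) := con 2 :* e :* n′ :* k :* (con 2 :* e :* a) :+ con 2 :* e :* n′ :* k :* o) refl e K N′ A Ω ⟩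
        N * K * (2 * e * A) + N * K * Ω ∎))
        where
        open ≤-Reasoning
        o : Fin T̂ → ℕ
        o = onPart (part host) i
        A = sum (λ j → o j * (𝟙 (good j) * weight j))

      inner : Copy r F host good
      inner = find good old-dense

      open Copy inner

      chooser : ∀ j → Dec (N′ ≤ cnt j) → Fin N′ → Fin N
      chooser j (yes le) = proj₁ (count-extract N′ (λ c → χ (old j c)) le)
      chooser j (no _)   = λ _ → fromℕ< 1≤N

      g : Fin T̂ → Fin N′ → Fin N
      g j = chooser j (N′ ≤? cnt j)

      g-spec : ∀ j → good j ≡ true → (∀ {c d} → g j c ≡ g j d → c ≡ d) × (∀ c → χ (old j (g j c)) ≡ true)
      g-spec j ok = go (N′ ≤? cnt j) ok
        where
        go : (d : Dec (N′ ≤ cnt j)) → does d ≡ true → (∀ {c c′} → chooser j d c ≡ chooser j d c′ → c ≡ c′) × (∀ c → χ (old j (chooser j d c)) ≡ true)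
        go (yes le) _ = proj₂ (count-extract N′ (λ c → χ (old j c)) le)

      sv : Fin (2 ^ L) → Fin T̂ → Fin N′ → Bool
      sv z j c = bit {L} z (combine j (g j c))

      S : Fin M → List (Fin (2 ^ L))
      S t = filter (λ z → χ (new t z) ≟ᵇ true) (allFin (2 ^ L))

      ∣S∣ : Fin M → ℕ
      ∣S∣ t = sum (λ z → 𝟙 (χ (new t z)))

      Outcome : Fin M → Set
      Outcome t = (∃ λ c → Shatters (S t) sv good c) ⊎
        (∃ λ X → (∀ j → length (X j) ≤ matchingBound N′ T̂) × (∀ {z} → z ∈ S t → Covered (fromℕ< 1≤N′) sv good X z))

      outcome : ∀ t → Outcome t
      outcome t = shatters-or-covered (fromℕ< 1≤N′) sv (S t) good

      success : ∀ t → Outcome t → Bool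
      success t (inj₁ _) = true
      success t (inj₂ _) = false

      -- Union bound: a selected neighbourhood agrees with one of the listed vectors on `N′` clones
      -- of a good class, which has probability `2 ^ (- N′)`; `N′` was chosen so that this outweighs
      -- the number of vectors, polynomial in `N′`.
      covered-small : ∀ t X → (∀ j → length (X j) ≤ matchingBound N′ T̂) →
        (∀ {z} → z ∈ S t → Covered (fromℕ< 1≤N′) sv good X z) → 2 * e * ∣S∣ t ≤ 2 ^ L
      covered-small t X short cov = *-cancelʳ-≤ _ _ (2 ^ N′) {{m^n≢0 2 N′}} (begin
        2 * e * ∣S∣ t * 2 ^ N′
          ≡⟨ *-assoc (2 * e) (∣S∣ t) (2 ^ N′) ⟩
        2 * e * (∣S∣ t * 2 ^ N′)
          ≤⟨ *-monoʳ-≤ (2 * e) (*-monoˡ-≤ (2 ^ N′) (sum-mono pointwise)) ⟩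
        2 * e * (sum (λ z → sum (λ j → sum (λ l → cyl j l z))) * 2 ^ N′)
          ≡⟨ cong (λ s → 2 * e * (s * 2 ^ N′)) (trans (sum-comm _) (sum-cong (λ j → sum-comm _))) ⟩
        2 * e * (sum (λ j → sum (λ l → sum (cyl j l))) * 2 ^ N′)
          ≡⟨ cong (2 * e *_) (trans (*-comm _ (2 ^ N′)) (trans (sum-*ˡ (2 ^ N′) _) (sum-cong (λ j → sum-*ˡ (2 ^ N′) _)))) ⟩
        2 * e * sum (λ j → sum (λ l → 2 ^ N′ * sum (cyl j l)))
          ≤⟨ *-monoʳ-≤ (2 * e) (sum-mono (λ j → ≤-trans (sum-mono (cyl-small j)) (≤-reflexive (sum-const _ (2 ^ L))))) ⟩
        2 * e * sum (λ j → length (X j) * 2 ^ L)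
          ≤⟨ *-monoʳ-≤ (2 * e) (≤-trans (sum-mono (λ j → *-monoˡ-≤ (2 ^ L) (short j))) (≤-reflexive (sum-const T̂ _))) ⟩
        2 * e * (T̂ * (matchingBound N′ T̂ * 2 ^ L))
          ≡⟨ solve 4 (λ e t m l → con 2 :* e :* (t :* (m :* l)) := con 2 :* e :* t :* m :* l) refl e T̂ (matchingBound N′ T̂) (2 ^ L) ⟩
        2 * e * T̂ * matchingBound N′ T̂ * 2 ^ L
          ≤⟨ *-monoˡ-≤ (2 ^ L) N′-large ⟩
        2 ^ N′ * 2 ^ L
          ≡⟨ *-comm (2 ^ N′) (2 ^ L) ⟩
        2 ^ L * 2 ^ N′ ∎)
        where
        open ≤-Reasoning
        agrees : Fin (2 ^ L) → Fin T̂ → (Fin N′ → Bool) → ℕ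
        agrees z j x = prod (λ c → 𝟙 (does (sv z j c ≟ᵇ x c)))

        cyl : ∀ j → Fin (length (X j)) → Fin (2 ^ L) → ℕ
        cyl j l z = 𝟙 (good j) * agrees z j (lookup (X j) l)

        cyl-small : ∀ j l → 2 ^ N′ * sum (cyl j l) ≤ 2 ^ L
        cyl-small j l = go (good j) refl
          where
          go : ∀ b → good j ≡ b → 2 ^ N′ * sum (λ z → 𝟙 b * agrees z j (lookup (X j) l)) ≤ 2 ^ L
          go false _  = ≤-trans (≤-reflexive (trans (cong (2 ^ N′ *_) (sum-zero (2 ^ L))) (*-zeroʳ (2 ^ N′)))) z≤n
          go true  ok = ≤-reflexive (trans (*-comm (2 ^ N′) _) (trans
            (cong (_* 2 ^ N′) (sum-cong (λ z → *-identityˡ _)))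
            (cylinder (λ c → combine j (g j c)) (λ eq → proj₁ (g-spec j ok) (proj₂ (combine-injective j (g j _) j (g j _) eq))) (lookup (X j) l))))

        pointwise : ∀ z → 𝟙 (χ (new t z)) ≤ sum (λ j → sum (λ l → cyl j l z))
        pointwise z = 𝟙-mono (χ (new t z)) λ χz → case cov (∈-filter⁺ (λ z → χ (new t z) ≟ᵇ true) (∈-allFin z) χz) of λ
          { (j , ok , at) → ≤-trans
              (Any-≤ (λ x → 𝟙 (good j) * agrees z j x) (λ x same → ≤-reflexive (≡.sym (trans (cong (λ b → 𝟙 b * agrees z j x) ok)
                (trans (*-identityˡ _) (prod-one _ (λ c → cong 𝟙 (dec-true (sv z j c ≟ᵇ x c) (same c)))))))) at)
              (term≤sum (λ j → sum (λ l → cyl j l z)) j) }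

      fibre-bound : ∀ t (o : Outcome t) → 2 * e * ∣S∣ t ≤ 2 ^ L + 2 * e * 2 ^ L * 𝟙 (success t o)
      fibre-bound t (inj₁ _) = ≤-trans (*-monoʳ-≤ (2 * e) (≤-trans (sum-mono (λ z → 𝟙≤1 (χ (new t z)))) (≤-reflexive (ones (2 ^ L)))))
        (≤-trans (≤-reflexive (≡.sym (*-identityʳ _))) (m≤n+m _ (2 ^ L)))
      fibre-bound t (inj₂ (X , short , cov)) = ≤-trans (covered-small t X short cov) (m≤m+n (2 ^ L) _)

      #success : ℕ
      #success = sum (λ t → 𝟙 (success t (outcome t)))

      -- A failing fibre has density at most `1 / (2e)`, while the average density is at least
      -- `1 / e`. So at least `M / (2e) = Y * T + 1` fibres succeed.
      many : Y * T < #success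
      many = *-cancelˡ-≤ (2 * e) (*-cancelʳ-≤ _ _ (2 ^ L) {{m^n≢0 2 L}} (+-cancelˡ-≤ K _ _ (begin
        K + K                                   ≡⟨ cong (K +_) (+-identityʳ K) ⟨
        2 * K                                   ≤⟨ *-monoʳ-≤ 2 new-dense ⟩
        2 * (e * sum ∣S∣)                       ≡⟨ trans (≡.sym (*-assoc 2 e (sum ∣S∣))) (sum-*ˡ (2 * e) ∣S∣) ⟩
        sum (λ t → 2 * e * ∣S∣ t)               ≤⟨ sum-mono (λ t → fibre-bound t (outcome t)) ⟩
        sum (λ t → 2 ^ L + 2 * e * 2 ^ L * 𝟙 (success t (outcome t)))
          ≡⟨ trans (sum-+ _ _) (cong₂ _+_ (sum-const M (2 ^ L)) (≡.sym (sum-*ˡ (2 * e * 2 ^ L) _))) ⟩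
        K + 2 * e * 2 ^ L * #success            ≡⟨ cong (K +_) (solve 3 (λ e l s → con 2 :* e :* l :* s := con 2 :* e :* s :* l) refl e (2 ^ L) #success) ⟩
        K + 2 * e * #success * 2 ^ L            ∎)))
        where
        open ≤-Reasoning
        new-dense : K ≤ e * sum ∣S∣
        new-dense = *-cancelˡ-≤ (Ω * N) {{>-nonZero (*-mono-≤ 1≤Ω 1≤N)}} (≤-trans (dense r (n<1+n r))
          (≤-reflexive (trans (cong (e *_) (sum-on-new (𝟙 ∘ χ))) (solve 3 (λ e o s → e :* (o :* s) := o :* (e :* s)) refl e (Ω * N) (sum ∣S∣)))))

      common : ∃ λ y → Σ (Fin T → Fin M) λ τ → (∀ {i j} → τ i ≡ τ j → i ≡ j) × (∀ i → Shatters (S (τ i)) sv good (finToFun y))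
      common = popular-colour {P = λ t y → Shatters (S t) sv good (finToFun y)} T (λ t → success t (outcome t)) (λ t → colour t (outcome t)) many
        where
        colour : ∀ t (o : Outcome t) → success t o ≡ true → ∃ λ (y : Fin Y) → Shatters (S t) sv good (finToFun y)
        colour t (inj₁ (c , sh)) _ = funToFin c , λ π → let z , z∈ , ok = sh π in
          z , z∈ , λ j gj → trans (cong (sv z j) (finToFun-funToFin c j)) (ok j gj)

      c : Fin T̂ → Fin N′
      c = finToFun (proj₁ common)

      τ : Fin T → Fin M
      τ = proj₁ (proj₂ common)

      rows : ∀ x → ∃ λ π → ∀ y → part F y < r → π (θ y) ≡ link F x y
      rows x = extend-along (λ y → part F y <? r) θ injective (link F x)

      witness : ∀ x → ∃ λ z → z ∈ S (τ x) × (∀ j → good j ≡ true → sv z j (c j) ≡ proj₁ (rows x) j)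
      witness x = proj₂ (proj₂ (proj₂ common)) x (proj₁ (rows x))

      kind′ : ∀ x → Dec (part F x < r) → Kind
      kind′ x (yes _) = inj₁ (θ x , g (θ x) (c (θ x)))
      -- This also catches parts beyond `r`, on which the copy has no condition to meet.
      kind′ x (no _)  = inj₂ (τ x , proj₁ (witness x))

      vertex : Kind → Fin (L + K)
      vertex (inj₁ (j , c)) = old j c
      vertex (inj₂ (t , z)) = new t z

      kind-vertex : ∀ k → kind (vertex k) ≡ k
      kind-vertex (inj₁ (j , c)) = kind-old j c
      kind-vertex (inj₂ (t , z)) = kind-new t z

      θ′ : Fin T → Fin (L + K)
      θ′ x = vertex (kind′ x (part F x <? r))

      kind-θ′ : ∀ x → kind (θ′ x) ≡ kind′ x (part F x <? r)
      kind-θ′ x = kind-vertex (kind′ x (part F x <? r))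

      copy : Copy (suc r) F host′ χ
      copy = record
        { θ         = θ′
        ; selected  = λ x _ → selected′ x (part F x <? r)
        ; samePart  = λ x lt → trans (cong part′ (kind-θ′ x)) (samePart′ x lt (part F x <? r))
        ; injective = λ x y _ _ eq → injective′ x y (part F x <? r) (part F y <? r)
            (trans (≡.sym (kind-θ′ x)) (trans (cong kind eq) (kind-θ′ y)))
        ; linked    = λ x y ltx lty → trans (cong₂ link′ (kind-θ′ x) (kind-θ′ y)) (linked′ x y ltx lty (part F x <? r) (part F y <? r))
        }
        where
        selected′ : ∀ x d → χ (vertex (kind′ x d)) ≡ true
        selected′ x (yes lt) = proj₂ (g-spec (θ x) (selected x lt)) (c (θ x))
        selected′ x (no _)   = proj₂ (∈-filter⁻ (λ z → χ (new (τ x) z) ≟ᵇ true) {xs = allFin (2 ^ L)} (proj₁ (proj₂ (witness x))))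

        samePart′ : ∀ x → part F x < suc r → ∀ d → part′ (kind′ x d) ≡ part F x
        samePart′ x _  (yes lt) = samePart x lt
        samePart′ x lt (no ≮r)  = ≤-antisym (≮⇒≥ ≮r) (≤-pred lt)

        injective′ : ∀ x y d d′ → kind′ x d ≡ kind′ y d′ → x ≡ y
        injective′ x y (yes lt) (yes lt′) eq = injective x y lt lt′ (cong proj₁ (inj₁-injective eq))
        injective′ x y (no _) (no _) eq = proj₁ (proj₂ (proj₂ common)) (cong proj₁ (inj₂-injective eq))

        linked′ : ∀ x y → part F x < suc r → part F y < part F x → ∀ d d′ → link′ (kind′ x d) (kind′ y d′) ≡ link F x y
        linked′ x y ltx lty (yes lt) (yes _) = linked x y lt lty
        linked′ x y ltx lty (no _) (yes lt) =
          trans (proj₂ (proj₂ (witness x)) (θ y) (selected y lt)) (proj₂ (rows x) y lt)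
        linked′ x y ltx lty _ (no ≮r) = contradiction (<-≤-trans lty (≤-pred ltx)) ≮r

  extended : DenseHost (suc r) e F
  extended = record
    { host = host′ ; weight = weight′ ∘ kind ; Ω = Ω′ ; 1≤Ω = *-mono-≤ (*-mono-≤ 1≤Ω 1≤N) 1≤K
    ; unused = unused′ ; balanced = balanced′ ; total = total′ ; find = Find.copy }

-- Each further part is paid for by doubling the `e` demanded of the smaller host.
dense-host : ∀ r e F → 1 ≤ e → DenseHost r e F
dense-host zero e F _ = record
  -- A single vertex of weight zero gives `θ` a target when there are no parts.
  { host = record { size = 1 ; part = λ _ → 0 ; link = λ _ _ → false }
  ; weight = λ _ → 0 ; Ω = 1 ; 1≤Ω = s≤s z≤n ; unused = λ _ _ → refl ; balanced = λ i ()
  ; total = ≤-reflexive (sum-zero 1)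
  ; find = λ χ _ → record
      { θ = λ _ → zero ; selected = λ x () ; samePart = λ x () ; injective = λ x y () ; linked = λ x y () } }
dense-host (suc r) (suc e₀) F _ = DenseStep.extended r e₀ F (dense-host r (2 * suc e₀) F (s≤s z≤n))

-- Ramsey's theorem and a large subset of small maximum degree

-- The usual induction on a first vertex `x`: its neighbours or its non-neighbours number at least
-- half of `2 ^ (a + b)`, which suffices when `a` or `b` is lowered by one.
ramsey : ∀ {V : Set} (K : V → V → Bool) → (∀ x y → K x y ≡ K y x) → ∀ a b (xs : List V) → Unique xs → 2 ^ (a + b) ≤ length xs →
  (Σ (Fin a → V) λ Q → (∀ i → Q i ∈ xs) × (∀ i j → i ≢ j → Q i ≢ Q j × K (Q i) (Q j) ≡ true)) ⊎
  (Σ (Fin b → V) λ Q → (∀ i → Q i ∈ xs) × (∀ i j → i ≢ j → Q i ≢ Q j × K (Q i) (Q j) ≡ false))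
ramsey K K-sym zero b xs uniq len = inj₁ ((λ ()) , (λ ()) , λ ())
ramsey K K-sym (suc a) zero xs uniq len = inj₂ ((λ ()) , (λ ()) , λ ())
ramsey {V} K K-sym (suc a) (suc b) [] uniq len = contradiction (≤-trans (m^n>0 2 (suc a + suc b)) len) λ ()
ramsey {V} K K-sym (suc a) (suc b) (x ∷ xs) (x∉ ∷ uniq) len = split (2 ^ (a + suc b) ≤? length (side true))
  where
  side : Bool → List V
  side β = filter (λ y → K x y ≟ᵇ β) xs

  side⊆ : ∀ β {y} → y ∈ side β → y ∈ xs × K x y ≡ β
  side⊆ β = ∈-filter⁻ (λ y → K x y ≟ᵇ β) {xs = xs}

  extend : ∀ β {c} → (Σ (Fin c → V) λ Q → (∀ i → Q i ∈ side β) × (∀ i j → i ≢ j → Q i ≢ Q j × K (Q i) (Q j) ≡ β)) →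
    Σ (Fin (suc c) → V) λ Q → (∀ i → Q i ∈ x ∷ xs) × (∀ i j → i ≢ j → Q i ≢ Q j × K (Q i) (Q j) ≡ β)
  extend β {c} (Q , Q∈ , hom) = Q′ , Q′∈ , hom′
    where
    Q′ : Fin (suc c) → V
    Q′ zero    = x
    Q′ (suc i) = Q i
    Q′∈ : ∀ i → Q′ i ∈ x ∷ xs
    Q′∈ zero    = here refl
    Q′∈ (suc i) = there (proj₁ (side⊆ β (Q∈ i)))
    x≢ : ∀ i → x ≢ Q i
    x≢ i = All.lookup x∉ (proj₁ (side⊆ β (Q∈ i)))
    hom′ : ∀ i j → i ≢ j → Q′ i ≢ Q′ j × K (Q′ i) (Q′ j) ≡ β
    hom′ zero    zero    ne = contradiction refl ne
    hom′ zero    (suc j) ne = x≢ j , proj₂ (side⊆ β (Q∈ j))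
    hom′ (suc i) zero    ne = x≢ i ∘ ≡.sym , trans (K-sym (Q i) x) (proj₂ (side⊆ β (Q∈ i)))
    hom′ (suc i) (suc j) ne = hom i j (ne ∘ cong suc)

  widen : ∀ β {c γ} → (Σ (Fin c → V) λ Q → (∀ i → Q i ∈ side β) × (∀ i j → i ≢ j → Q i ≢ Q j × K (Q i) (Q j) ≡ γ)) →
    Σ (Fin c → V) λ Q → (∀ i → Q i ∈ x ∷ xs) × (∀ i j → i ≢ j → Q i ≢ Q j × K (Q i) (Q j) ≡ γ)
  widen β (Q , Q∈ , hom) = Q , (λ i → there (proj₁ (side⊆ β (Q∈ i)))) , hom

  split : Dec (2 ^ (a + suc b) ≤ length (side true)) → _
  split (yes big) with ramsey K K-sym a (suc b) (side true) (Unique.filter⁺ (λ y → K x y ≟ᵇ true) uniq) big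
  ... | inj₁ s = inj₁ (extend true s)
  ... | inj₂ s = inj₂ (widen true s)
  split (no small) with ramsey K K-sym (suc a) b (side false) (Unique.filter⁺ (λ y → K x y ≟ᵇ false) uniq) big
    where
    h = 2 ^ (a + suc b)
    big : 2 ^ (suc a + b) ≤ length (side false)
    big = subst (λ t → 2 ^ t ≤ length (side false)) (+-suc a b) (+-cancelʳ-≤ h _ _ (begin
      h + h                                        ≡⟨ cong (h +_) (+-identityʳ h) ⟨
      2 ^ (suc a + suc b)                          ≤⟨ len ⟩
      suc (length xs)                              ≡⟨ cong suc (length-filter-split (K x) xs) ⟩
      suc (length (side false) + length (side true)) ≡⟨ +-suc _ _ ⟨
      length (side false) + suc (length (side true)) ≤⟨ +-monoʳ-≤ (length (side false)) (≰⇒> small) ⟩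
      length (side false) + h                      ∎))
      where open ≤-Reasoning
  ... | inj₁ s = inj₁ (widen false s)
  ... | inj₂ s = inj₂ (extend false s)

module Cleaning {n : ℕ} (D : Fin n → Fin n → Bool) (D-sym : ∀ u v → D u v ≡ D v u) (D-irrefl : ∀ u → D u u ≡ false) where

  card : (Fin n → Bool) → ℕ
  card χ = sum (λ v → 𝟙 (χ v))

  deg : (Fin n → Bool) → Fin n → ℕ
  deg χ u = sum (λ v → 𝟙 (χ v) * 𝟙 (D v u))

  edges : (Fin n → Bool) → ℕ
  edges χ = sum (λ u → 𝟙 (χ u) * deg χ u)

  private
    delete : (Fin n → Bool) → Fin n → Fin n → Bool
    delete χ v u = χ u ∧ not (does (u ≟ v))

    𝟙-delete : ∀ χ v → χ v ≡ true → ∀ u → 𝟙 (χ u) ≡ 𝟙 (delete χ v u) + 𝟙 (does (u ≟ v))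
    𝟙-delete χ v χv u with u ≟ v
    ... | yes refl = trans (cong 𝟙 χv) (cong (λ b → 𝟙 (b ∧ false) + 1) (≡.sym χv))
    ... | no  _ = go (χ u)
      where
      go : ∀ b → 𝟙 b ≡ 𝟙 (b ∧ true) + 0
      go true  = refl
      go false = refl

    sum-delete : ∀ χ v → χ v ≡ true → (f : Fin n → ℕ) →
      sum (λ u → 𝟙 (χ u) * f u) ≡ sum (λ u → 𝟙 (delete χ v u) * f u) + f v
    sum-delete χ v χv f = trans
      (sum-cong (λ u → trans (cong (_* f u) (𝟙-delete χ v χv u)) (*-distribʳ-+ (f u) (𝟙 (delete χ v u)) (𝟙 (does (u ≟ v))))))
      (trans (sum-+ _ _) (cong (sum (λ u → 𝟙 (delete χ v u) * f u) +_) (sum-δ v f)))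

    card-delete : ∀ χ v → χ v ≡ true → card χ ≡ suc (card (delete χ v))
    card-delete χ v χv = trans (sum-cong (λ u → ≡.sym (*-identityʳ _))) (trans (sum-delete χ v χv (λ _ → 1))
      (trans (+-comm _ 1) (cong suc (sum-cong (λ u → *-identityʳ _)))))

    deg-delete : ∀ χ v → χ v ≡ true → deg χ v ≡ deg (delete χ v) v
    deg-delete χ v χv = trans (sum-delete χ v χv (λ w → 𝟙 (D w v)))
      (trans (cong (λ b → deg (delete χ v) v + 𝟙 b) (D-irrefl v)) (+-identityʳ _))

    edges-delete : ∀ χ v → χ v ≡ true → edges χ ≡ edges (delete χ v) + 2 * deg χ v
    edges-delete χ v χv = begin
      edges χ
        ≡⟨ sum-delete χ v χv (deg χ) ⟩
      sum (λ u → 𝟙 (χ′ u) * deg χ u) + deg χ v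
        ≡⟨ cong (_+ deg χ v) (trans (sum-cong (λ u → trans (cong (𝟙 (χ′ u) *_) (sum-delete χ v χv (λ w → 𝟙 (D w u)))) (*-distribˡ-+ (𝟙 (χ′ u)) (deg χ′ u) (𝟙 (D v u))))) (sum-+ _ _)) ⟩
      edges χ′ + sum (λ u → 𝟙 (χ′ u) * 𝟙 (D v u)) + deg χ v
        ≡⟨ cong (λ s → edges χ′ + s + deg χ v) (trans (sum-cong (λ u → cong (λ b → 𝟙 (χ′ u) * 𝟙 b) (D-sym v u))) (≡.sym (deg-delete χ v χv))) ⟩
      edges χ′ + deg χ v + deg χ v
        ≡⟨ solve 2 (λ e d → e :+ d :+ d := e :+ con 2 :* d) refl (edges χ′) (deg χ v) ⟩
      edges χ′ + 2 * deg χ v ∎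
      where
      open ≡-Reasoning
      χ′ = delete χ v

  module _ (A B s : ℕ) where

    -- Deleting a vertex of large degree preserves this invariant, which forces card χ to stay large.
    Sparse : (Fin n → Bool) → Set
    Sparse χ = A * edges χ + s ≤ B * (card χ * card χ)

    private
      -- The deletion lowers the left side by `2 * A * deg χ v`, more than `2 * B * card χ`, and the
      -- right side only by `B * (2 * card χ - 1)`.
      sparse-delete : ∀ χ v → χ v ≡ true → B * card χ < A * deg χ v → Sparse χ → Sparse (delete χ v)
      sparse-delete χ v χv large inv = +-cancelʳ-≤ (2 * (B * suc a)) _ _ (begin
        A * edges χ′ + s + 2 * (B * suc a)      ≤⟨ +-monoʳ-≤ (A * edges χ′ + s) (*-monoʳ-≤ 2 (<⇒≤ (subst (λ c → B * c < A * deg χ v) (card-delete χ v χv) large))) ⟩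
        A * edges χ′ + s + 2 * (A * deg χ v)    ≡⟨ solve 4 (λ A e s d → A :* e :+ s :+ con 2 :* (A :* d) := A :* (e :+ con 2 :* d) :+ s) refl A (edges χ′) s (deg χ v) ⟩
        A * (edges χ′ + 2 * deg χ v) + s        ≡⟨ cong (λ e → A * e + s) (edges-delete χ v χv) ⟨
        A * edges χ + s                         ≤⟨ inv ⟩
        B * (card χ * card χ)                   ≡⟨ cong (λ c → B * (c * c)) (card-delete χ v χv) ⟩
        B * (suc a * suc a)                     ≤⟨ m≤m+n _ B ⟩
        B * (suc a * suc a) + B                 ≡⟨ solve 2 (λ B a → B :* ((con 1 :+ a) :* (con 1 :+ a)) :+ B := B :* (a :* a) :+ con 2 :* (B :* (con 1 :+ a))) refl B a ⟩
        B * (a * a) + 2 * (B * suc a)           ∎)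
        where
        open ≤-Reasoning
        χ′ = delete χ v
        a = card χ′

      descend : ∀ fuel χ → card χ ≤ fuel → Sparse χ →
        ∃ λ χ′ → Sparse χ′ × (∀ u → χ′ u ≡ true → A * deg χ′ u ≤ B * card χ′)
      descend fuel χ le inv with any? (λ u → (χ u ≟ᵇ true) ×-dec (B * card χ <? A * deg χ u))
      ... | no ∄ = χ , inv , λ u χu → ≮⇒≥ λ lt → ∄ (u , χu , lt)
      descend zero χ le inv | yes (v , χv , _) = contradiction (subst (_≤ 0) (card-delete χ v χv) le) λ ()
      descend (suc fuel) χ le inv | yes (v , χv , large) =
        descend fuel (delete χ v) (≤-pred (subst (_≤ suc fuel) (card-delete χ v χv) le)) (sparse-delete χ v χv large inv)

    clean : ∀ χ → Sparse χ → ∃ λ χ′ → Sparse χ′ × (∀ u → χ′ u ≡ true → A * deg χ′ u ≤ B * card χ′)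
    clean χ = descend (card χ) χ ≤-refl

-- Embedding patterns into a graph close to the host graph

labelAdj : ∀ {ℓ} → Fin ℓ × Fin (2 ^ ℓ) → Fin ℓ × Fin (2 ^ ℓ) → Bool
labelAdj {ℓ} (p , q) (p′ , q′) = bit {ℓ} q p′ xor bit {ℓ} q′ p

-- The parameter m of the theorem is suc m here; c bounds the number of vertices with the same label.
record Setting (k m ℓ : ℕ) {n} (G : Graph n) : Set where
  field
    χ       : Fin n → Bool
    p       : Fin n → Fin ℓ
    q       : Fin n → Fin (2 ^ ℓ)
    c       : ℕ
    1≤c     : 1 ≤ c
    balance : ∀ (f : Fin ℓ → Fin (2 ^ ℓ) → ℕ) → sum (λ v → f (p v) (q v)) ≤ c * sum (λ t → sum (λ z → f t z))

  -- The error graph: the pairs in which `G` differs from the host graph.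
  D : Fin n → Fin n → Bool
  D u v = labelAdj (p u , q u) (p v , q v) xor adj G u v

  a : ℕ
  a = sum (λ v → 𝟙 (χ v))

  field
    large  : c * (ℓ * 2 ^ ℓ) ≤ 4 * suc m * a
    -- Over at most `k` parts these error densities add up to at most `(2m + 1) / (4m + 4)`, a
    -- constant below `1 / 2`.
    sparse : ∀ u → χ u ≡ true → 4 * k * suc m * sum (λ v → 𝟙 (χ v) * 𝟙 (D v u)) ≤ suc (2 * m) * a

-- Distinct first labels make the adjacency vectors between a host fibre and the embedded vertices
-- uniformly distributed. `colour` records which parts are cliques and which are cocliques.
record Embedding {k m ℓ n} {G : Graph n} (S : Setting k m ℓ G) (r : ℕ) (F : Pattern) : Set where
  open Setting S
  field
    ψ       : Fin (size F) → Fin n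
    inside  : ∀ x → χ (ψ x) ≡ true
    labels  : ∀ x y → part F x < r → part F y < r → p (ψ x) ≡ p (ψ y) → x ≡ y
    linked  : ∀ x y → part F x < r → part F y < part F x → adj G (ψ x) (ψ y) ≡ link F x y
    colour  : ℕ → Bool
    uniform : ∀ x y → part F x < r → part F x ≡ part F y → x ≢ y → adj G (ψ x) (ψ y) ≡ colour (part F x)

blowUp : Pattern → ℕ → Pattern
blowUp F N = record
  { size = size F * N
  ; part = λ w → part F (quotient N w)
  ; link = λ w w′ → link F (quotient N w) (quotient N w′) }

record Attachable {k m ℓ n} {G : Graph n} (S : Setting k m ℓ G) (r : ℕ) (F : Pattern) (R : ℕ) : Set where
  open Setting S
  field
    embedding : Embedding S r F
  open Embedding embedding public
  field
    τ      : Fin R → Fin ℓ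
    τ-inj  : ∀ {i j} → τ i ≡ τ j → i ≡ j
    fresh  : ∀ i x → p (ψ x) ≢ τ i
    attach : ∀ i (π : Fin (size F) → Bool) → ∃ λ w → χ w ≡ true × p w ≡ τ i × (∀ x → part F x < r → adj G w (ψ x) ≡ π x)

module Attach {k m ℓ r : ℕ} (1≤k : 1 ≤ k) (r≤k : r ≤ k) (F : Pattern) (R : ℕ) (H : DenseHost r (8 * suc m) F)
  (N₁ : ℕ) (1≤N₁ : 1 ≤ N₁) where

  open DenseHost H
  private
    -- The radius is the fraction 1 - 1 / (8 (m + 1)) of the expected distance N / 2.
    c₀ c₁ T T̂ N L Y rad : ℕ
    c₀ = 7 + 8 * m
    c₁ = suc c₀
    T = size F
    T̂ = size host
    N = 2 * c₁ * N₁
    L = T̂ * N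
    Y = L ^ T
    rad = c₀ * N₁

  -- `ball` will bound the share of a fibre near any exceptional vector by `1 / (32 (m + 1)^2)`;
  -- `ℓ-large` provides enough labels for the final pigeonhole.
  module _ (ball : 32 * suc m * suc m * (suc T̂ * (2 ^ T̂ * matchingBound N T̂)) * (c₁ + suc c₁) ^ N ≤ c₁ ^ rad * suc c₁ ^ (suc c₁ * N₁) * 2 ^ N)
    (ℓ-large : 32 * suc m * suc m * (Y * suc R + L) < ℓ)
    {n : ℕ} {G : Graph n} (S : Setting k m ℓ G) (emb : Embedding S r (blowUp host N)) where

    open Setting S
    open Embedding emb
    private
      1≤N : 1 ≤ N
      1≤N = *-mono-≤ {1} {2 * c₁} {1} {N₁} (s≤s z≤n) 1≤N₁

      U : Fin T̂ → Fin N → Fin n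
      U j c = ψ (combine j c)

      quotient-combine : ∀ (j : Fin T̂) (c : Fin N) → quotient N (combine j c) ≡ j
      quotient-combine j c = cong proj₁ (remQuot-combine j c)

      sv : Fin n → Fin T̂ → Fin N → Bool
      sv v j c = adj G v (U j c)

      inFibre? : ∀ t v → Dec (χ v ≡ true × p v ≡ t)
      inFibre? t v = (χ v ≟ᵇ true) ×-dec (p v ≟ t)

      fibre : Fin ℓ → List (Fin n)
      fibre t = filter (inFibre? t) (allFin n)

      d₀ : Fin N
      d₀ = fromℕ< 1≤N

      covers : ∀ t → ∃ λ (X : Fin T̂ → List (Fin N → Bool)) → (∀ j → length (X j) ≤ 2 ^ T̂ * matchingBound N T̂) ×
        (∀ {e} → e ∈ fibre t → ∃ λ c → Shatters (fibre t) sv (λ j → not (does (among? d₀ sv X e j))) c)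
      covers t = outside-shattered d₀ sv (fibre t)

      X : Fin ℓ → Fin T̂ → List (Fin N → Bool)
      X t = proj₁ (covers t)

      hostVec : Fin ℓ → Fin (2 ^ ℓ) → Fin T̂ → Fin N → Bool
      hostVec t z j c = labelAdj (t , z) (p (U j c) , q (U j c))

      near : Fin ℓ → Fin (2 ^ ℓ) → ∀ j → (Fin N → Bool) → ℕ
      near t z j x = 𝟙 (does (dist (hostVec t z j) x ≤? rad))

      bad : Fin ℓ → Fin (2 ^ ℓ) → ℕ
      bad t z = sum (λ j → 𝟙 (does (part host j <? r)) * sum (λ l → near t z j (lookup (X t j) l)))

      cost : Fin n → ℕ
      cost v = sum (λ j → weight j * sum (λ c → 𝟙 (D v (U j c))))

      -- In units of `Ω * N`, the threshold `(4m + 3) / (8m + 8)` lies above the bound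
      -- `(4m + 2) / (8m + 8)` on the average cost over `χ`, and below `(1 - 1/(8m + 8))^2 / 2`, the
      -- cost of missing all but a fraction `1 / (8m + 8)` of one part.
      Low : Fin n → Set
      Low v = 8 * suc m * cost v < (3 + 4 * m) * (Ω * N)

      hit? : ∀ t → Dec (∃ λ y → p (ψ y) ≡ t)
      hit? t = any? λ y → p (ψ y) ≟ t

      Witness-of : Fin ℓ → Set
      Witness-of t = ∃ λ v → (χ v ≡ true × p v ≡ t) × bad t (q v) ≡ 0 × Low v

      witness? : ∀ t → Dec (Witness-of t)
      witness? t = any? λ v → inFibre? t v ×-dec ((bad t (q v) ℕ.≟ 0) ×-dec (8 * suc m * cost v <? (3 + 4 * m) * (Ω * N)))

      good : Fin ℓ → Bool
      good t = not (does (hit? t)) ∧ does (witness? t)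

      -- Up to a shift by the bits of the embedded vertices at `t`, the host vector of `(t , z)`
      -- consists of the bits of `z` at distinct positions. So the host vectors are uniform and
      -- `ball-tail` applies.
      near-few : ∀ t j → part host j < r → ∀ x →
        32 * suc m * suc m * (suc T̂ * (2 ^ T̂ * matchingBound N T̂)) * sum (λ z → near t z j x) ≤ 2 ^ ℓ
      near-few t j j<r x = *-cancelʳ-≤ _ _ W {{>-nonZero 1≤W}} (begin
        Z * sum (λ z → near t z j x) * W          ≡⟨ cong (λ s → Z * s * W) (sum-cong (λ z → cong (λ d → 𝟙 (does (d ≤? rad))) (shift z))) ⟩
        Z * near# * W                             ≡⟨ *-assoc Z near# W ⟩
        Z * (near# * W)                           ≤⟨ *-monoʳ-≤ Z (subst (λ ex → near# * (c₁ ^ rad * suc c₁ ^ ex * 2 ^ N) ≤ 2 ^ ℓ * (c₁ + suc c₁) ^ N) exponent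
                                                       (ball-tail (λ c → p (U j c)) U-inj x′ c₁ rad rad≤N)) ⟩
        Z * (2 ^ ℓ * (c₁ + suc c₁) ^ N)           ≡⟨ solve 3 (λ z l b → z :* (l :* b) := l :* (z :* b)) refl Z (2 ^ ℓ) ((c₁ + suc c₁) ^ N) ⟩
        2 ^ ℓ * (Z * (c₁ + suc c₁) ^ N)           ≤⟨ *-monoʳ-≤ (2 ^ ℓ) ball ⟩
        2 ^ ℓ * W                                 ∎)
        where
        open ≤-Reasoning
        Z W : ℕ
        Z = 32 * suc m * suc m * (suc T̂ * (2 ^ T̂ * matchingBound N T̂))
        W = c₁ ^ rad * suc c₁ ^ (suc c₁ * N₁) * 2 ^ N
        1≤W : 1 ≤ W
        1≤W = *-mono-≤ {1} {c₁ ^ rad * suc c₁ ^ (suc c₁ * N₁)} {1} {2 ^ N} (*-mono-≤ {1} {c₁ ^ rad} {1} {suc c₁ ^ (suc c₁ * N₁)} (m^n>0 c₁ rad) (m^n>0 (suc c₁) (suc c₁ * N₁))) (m^n>0 2 N)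
        x′ : Fin N → Bool
        x′ c = bit {ℓ} (q (U j c)) t xor x c
        near# : ℕ
        near# = sum {2 ^ ℓ} (λ z → 𝟙 (does (dist (bit {ℓ} z ∘ (λ c → p (U j c))) x′ ≤? rad)))
        shift : ∀ z → dist (hostVec t z j) x ≡ dist (bit {ℓ} z ∘ (λ c → p (U j c))) x′
        shift z = sum-cong (λ c → cong 𝟙 (xor-assoc (bit {ℓ} z (p (U j c))) (bit {ℓ} (q (U j c)) t) (x c)))
        U-inj : ∀ {c d} → p (U j c) ≡ p (U j d) → c ≡ d
        U-inj {c} {d} eq = proj₂ (combine-injective j c j d (labels (combine j c) (combine j d)
          (subst (_< r) (cong (part host) (≡.sym (quotient-combine j c))) j<r)
          (subst (_< r) (cong (part host) (≡.sym (quotient-combine j d))) j<r) eq))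
        N≡ : rad + suc c₁ * N₁ ≡ N
        N≡ = solve 2 (λ c n → c :* n :+ (con 2 :+ c) :* n := con 2 :* (con 1 :+ c) :* n) refl c₀ N₁
        rad≤N : rad ≤ N
        rad≤N = ≤-trans (m≤m+n rad _) (≤-reflexive N≡)
        exponent : N ∸ rad ≡ suc c₁ * N₁
        exponent = trans (cong (_∸ rad) (≡.sym N≡)) (m+n∸m≡n rad (suc c₁ * N₁))

      bad-few : ∀ t → 32 * suc m * suc m * sum (bad t) ≤ 2 ^ ℓ
      bad-few t = *-cancelˡ-≤ T̂X {{>-nonZero 1≤T̂X}} (begin
        T̂X * (M * sum (bad t))
          ≡⟨ cong (λ s → T̂X * (M * s)) (trans (sum-comm _) (sum-cong (λ j → trans (≡.sym (sum-*ˡ (small j) _)) (cong (small j *_) (sum-comm _))))) ⟩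
        T̂X * (M * sum (λ j → small j * sum (λ l → near# j l)))
          ≡⟨ trans (≡.sym (*-assoc T̂X M _)) (trans (cong (_* sum (λ j → small j * sum (λ l → near# j l))) (*-comm T̂X M)) (sum-*ˡ (M * T̂X) _)) ⟩
        sum (λ j → M * T̂X * (small j * sum (λ l → near# j l)))
          ≤⟨ sum-mono each ⟩
        sum {T̂} (λ j → Q * 2 ^ ℓ)
          ≡⟨ trans (sum-const T̂ _) (≡.sym (*-assoc T̂ Q (2 ^ ℓ))) ⟩
        T̂ * Q * 2 ^ ℓ
          ≤⟨ *-monoˡ-≤ (2 ^ ℓ) (m≤n+m (T̂ * Q) Q) ⟩
        T̂X * 2 ^ ℓ ∎)
        where
        open ≤-Reasoning
        M Q T̂X : ℕ
        M = 32 * suc m * suc m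
        Q = 2 ^ T̂ * matchingBound N T̂
        -- `suc T̂` in place of `T̂` keeps the factor positive, so that it can be cancelled.
        T̂X = suc T̂ * Q
        1≤T̂X : 1 ≤ T̂X
        1≤T̂X = *-mono-≤ {1} {suc T̂} {1} {Q} (s≤s z≤n) (*-mono-≤ (m^n>0 2 T̂) (1≤matchingBound N T̂))
        small : Fin T̂ → ℕ
        small j = 𝟙 (does (part host j <? r))
        near# : ∀ j → Fin (length (X t j)) → ℕ
        near# j l = sum (λ z → near t z j (lookup (X t j) l))
        each : ∀ j → M * T̂X * (small j * sum (λ l → near# j l)) ≤ Q * 2 ^ ℓ
        each j with part host j <? r
        ... | no  ≮r = ≤-trans (≤-reflexive (trans (cong (λ b → M * T̂X * (𝟙 b * sum (λ l → near# j l))) (dec-false (part host j <? r) ≮r)) (*-zeroʳ (M * T̂X)))) z≤n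
        ... | yes <r = begin
          M * T̂X * (small j * sum (λ l → near# j l))  ≤⟨ *-monoʳ-≤ (M * T̂X) (≤-trans (*-monoˡ-≤ (sum (λ l → near# j l)) (𝟙≤1 (does (part host j <? r)))) (≤-reflexive (*-identityˡ _))) ⟩
          M * T̂X * sum (λ l → near# j l)              ≡⟨ sum-*ˡ (M * T̂X) _ ⟩
          sum (λ l → M * T̂X * near# j l)              ≤⟨ sum-mono (λ l → near-few t j <r (lookup (X t j) l)) ⟩
          sum {length (X t j)} (λ l → 2 ^ ℓ)          ≡⟨ sum-const _ _ ⟩
          length (X t j) * 2 ^ ℓ                      ≤⟨ *-monoˡ-≤ (2 ^ ℓ) (proj₁ (proj₂ (covers t)) j) ⟩
          Q * 2 ^ ℓ                                   ∎

      module Witness (v : Fin n) (χv : χ v ≡ true) (bad≡0 : bad (p v) (q v) ≡ 0) (low : Low v) where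

        sel : Fin T̂ → Bool
        sel j = not (does (among? d₀ sv (X (p v)) v j))

        errors : Fin T̂ → ℕ
        errors j = sum (λ c → 𝟙 (D v (U j c)))

        -- The vector of `v` in `G` is one of the exceptional vectors, whereas its host vector is
        -- farther than `rad` from all of them because `bad` vanishes; the errors are exactly the
        -- coordinates in which the two differ.
        far : ∀ j → part host j < r → sel j ≡ false → rad ≤ errors j
        far j j<r out = go (among? d₀ sv (X (p v)) v j) out
          where
          go : (d : Dec (Any (λ x → sv v j ≗ x) (X (p v) j))) → not (does d) ≡ false → rad ≤ errors j
          go (yes at) _ = ≮⇒≥ λ close → n≮0 (subst (1 ≤_) bad≡0 (begin
            1                                                          ≤⟨ Any-≤ (near (p v) (q v) j) (λ x same → ≤-reflexive (≡.sym (cong 𝟙 (dec-true (_ ≤? rad)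
                                                                            (subst (_≤ rad) (sum-cong (λ c → cong (λ b → 𝟙 (hostVec (p v) (q v) j c xor b)) (same c))) (<⇒≤ close)))))) at ⟩
            near# j                                                    ≡⟨ *-identityˡ _ ⟨
            1 * near# j                                                ≡⟨ cong (λ b → 𝟙 b * near# j) (dec-true (part host j <? r) j<r) ⟨
            𝟙 (does (part host j <? r)) * near# j                      ≤⟨ term≤sum (λ j → 𝟙 (does (part host j <? r)) * near# j) j ⟩
            bad (p v) (q v)                                            ∎))
            where
            open ≤-Reasoning
            near# : Fin T̂ → ℕ
            near# j = sum (λ l → near (p v) (q v) j (lookup (X (p v) j) l))

        -- Otherwise all but a fraction `1 / (8m + 8)` of the weight of part `i` is unselected and
        -- pays at least `rad` errors per class, contradicting `Low`. There is little room:
        -- `(8m + 7)^2 = 64m^2 + 112m + 49` against `64m^2 + 112m + 48`.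
        dense : ∀ i → i < r → Ω ≤ 8 * suc m * sum (λ j → onPart (part host) i j * (𝟙 (sel j) * weight j))
        dense i i<r = ≮⇒≥ λ sparse → <⇒≱ low (begin
          (3 + 4 * m) * (Ω * N)              ≡⟨ solve 3 (λ m o n → (con 3 :+ con 4 :* m) :* (o :* (con 2 :* (con 8 :+ con 8 :* m) :* n)) := n :* ((con 48 :+ con 112 :* m :+ con 64 :* m :* m) :* o)) refl m Ω N₁ ⟩
          N₁ * ((48 + 112 * m + 64 * m * m) * Ω) ≤⟨ *-monoʳ-≤ N₁ (*-monoˡ-≤ Ω (n≤1+n (48 + 112 * m + 64 * m * m))) ⟩
          N₁ * ((49 + 112 * m + 64 * m * m) * Ω) ≡⟨ solve 3 (λ m o n → n :* ((con 49 :+ con 112 :* m :+ con 64 :* m :* m) :* o) := (con 7 :+ con 8 :* m) :* n :* ((con 7 :+ con 8 :* m) :* o)) refl m Ω N₁ ⟩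
          rad * (c₀ * Ω)                     ≤⟨ *-monoʳ-≤ rad (unselected sparse) ⟩
          rad * (8 * suc m * B)              ≡⟨ solve 3 (λ r e b → r :* (e :* b) := e :* (r :* b)) refl rad (8 * suc m) B ⟩
          8 * suc m * (rad * B)              ≤⟨ *-monoʳ-≤ (8 * suc m) (≤-trans (≤-reflexive (sum-*ˡ rad _)) (sum-mono charge)) ⟩
          8 * suc m * cost v                 ∎)
          where
          open ≤-Reasoning
          o : Fin T̂ → ℕ
          o = onPart (part host) i
          A B : ℕ
          A = sum (λ j → o j * (𝟙 (sel j) * weight j))
          B = sum (λ j → o j * (𝟙 (not (sel j)) * weight j))
          A+B≡Ω : A + B ≡ Ω
          A+B≡Ω = trans (≡.sym (sum-+ _ _)) (trans (sum-cong (λ j → both (o j) (sel j) (weight j))) (balanced i i<r))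
            where
            both : ∀ o s w → o * (𝟙 s * w) + o * (𝟙 (not s) * w) ≡ o * w
            both o true  w = solve 2 (λ o w → o :* (con 1 :* w) :+ o :* con 0 := o :* w) refl o w
            both o false w = solve 2 (λ o w → o :* con 0 :+ o :* (con 1 :* w) := o :* w) refl o w
          unselected : 8 * suc m * A < Ω → c₀ * Ω ≤ 8 * suc m * B
          unselected sparse = +-cancelˡ-≤ Ω _ _ (begin
            Ω + c₀ * Ω                       ≡⟨ solve 2 (λ m o → o :+ (con 7 :+ con 8 :* m) :* o := con 8 :* (con 1 :+ m) :* o) refl m Ω ⟩
            8 * suc m * Ω                    ≡⟨ cong (8 * suc m *_) A+B≡Ω ⟨
            8 * suc m * (A + B)              ≡⟨ *-distribˡ-+ (8 * suc m) A B ⟩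
            8 * suc m * A + 8 * suc m * B    ≤⟨ +-monoˡ-≤ (8 * suc m * B) (<⇒≤ sparse) ⟩
            Ω + 8 * suc m * B                ∎)
          charge : ∀ j → rad * (o j * (𝟙 (not (sel j)) * weight j)) ≤ weight j * errors j
          charge j = go (part host j ℕ.≟ i) (sel j) refl
            where
            go : (d : Dec (part host j ≡ i)) → ∀ s → sel j ≡ s → rad * (𝟙 (does d) * (𝟙 (not s) * weight j)) ≤ weight j * errors j
            go (no _)     s     _   = ≤-trans (≤-reflexive (*-zeroʳ rad)) z≤n
            go (yes _)    true  _   = ≤-trans (≤-reflexive (*-zeroʳ rad)) z≤n
            go (yes refl) false out = ≤-trans (≤-reflexive (solve 2 (λ r w → r :* (con 1 :* (con 1 :* w)) := w :* r) refl rad (weight j)))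
              (*-monoʳ-≤ (weight j) (far j i<r out))

        copy : Copy r F host sel
        copy = find sel dense

        shattered : ∃ λ c → Shatters (fibre (p v)) sv sel c
        shattered = proj₂ (proj₂ (covers (p v))) (∈-filter⁺ (inFibre? (p v)) (∈-allFin v) (χv , refl))

      -- All that a label contributes, stated in terms of `κ` alone: there are only `Y` such maps,
      -- so many labels share one.
      record GoodAt (t : Fin ℓ) (κ : Fin T → Fin L) : Set where
        field
          unhit     : ∀ y → p (ψ y) ≢ t
          samePart  : ∀ x → part F x < r → part (blowUp host N) (κ x) ≡ part F x
          injective : ∀ x y → part F x < r → part F y < r → κ x ≡ κ y → x ≡ y
          links     : ∀ x y → part F x < r → part F y < part F x → link (blowUp host N) (κ x) (κ y) ≡ link F x y
          realise   : ∀ (π : Fin T → Bool) → ∃ λ w → χ w ≡ true × p w ≡ t × (∀ x → part F x < r → adj G w (ψ (κ x)) ≡ π x)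

      -- A map is recovered from its code only pointwise.
      goodAt-resp : ∀ {t κ κ′} → κ ≗ κ′ → GoodAt t κ → GoodAt t κ′
      goodAt-resp κ≗κ′ g = record
        { unhit     = unhit
        ; samePart  = λ x lt → trans (cong (part (blowUp host N)) (≡.sym (κ≗κ′ x))) (samePart x lt)
        ; injective = λ x y ltx lty eq → injective x y ltx lty (trans (κ≗κ′ x) (trans eq (≡.sym (κ≗κ′ y))))
        ; links     = λ x y ltx lty → trans (cong₂ (link (blowUp host N)) (≡.sym (κ≗κ′ x)) (≡.sym (κ≗κ′ y))) (links x y ltx lty)
        ; realise   = λ π → let w , χw , pw , ok = realise π in
            w , χw , pw , λ x lt → trans (cong (λ y → adj G w (ψ y)) (≡.sym (κ≗κ′ x))) (ok x lt)
        } where open GoodAt g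

      goodAt : ∀ v → χ v ≡ true → bad (p v) (q v) ≡ 0 → Low v → (∀ y → p (ψ y) ≢ p v) → ∃ λ κ → GoodAt (p v) κ
      goodAt v χv bad≡0 low unhit = (λ x → combine (θ x) (tr (θ x))) , record
        { unhit     = unhit
        ; samePart  = λ x lt → trans (cong (part host) (quotient-combine (θ x) (tr (θ x)))) (Copy.samePart copy x lt)
        ; injective = λ x y ltx lty eq → Copy.injective copy x y ltx lty (proj₁ (combine-injective (θ x) (tr (θ x)) (θ y) (tr (θ y)) eq))
        ; links     = λ x y ltx lty → trans (cong₂ (link host) (quotient-combine (θ x) (tr (θ x))) (quotient-combine (θ y) (tr (θ y)))) (Copy.linked copy x y ltx lty)
        ; realise   = λ π →
            let π′ , π′-θ = extend-along (λ x → part F x <? r) θ (Copy.injective copy) π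
                w , w∈ , ok = proj₂ shattered π′
                χw , pw = proj₂ (∈-filter⁻ (inFibre? (p v)) {xs = allFin n} w∈)
            in w , χw , pw , λ x lt → trans (ok (θ x) (Copy.selected copy x lt)) (π′-θ x lt)
        }
        where
        open Witness v χv bad≡0 low
        θ : Fin T → Fin T̂
        θ = Copy.θ copy
        tr : Fin T̂ → Fin N
        tr = proj₁ shattered

      goodAt-of : ∀ t → good t ≡ true → ∃ λ (y : Fin Y) → GoodAt t (finToFun y)
      goodAt-of t ok = go (hit? t) (witness? t) ok
        where
        coded : ∀ {t} → (∃ λ κ → GoodAt t κ) → ∃ λ (y : Fin Y) → GoodAt t (finToFun y)
        coded (κ , g) = funToFin κ , goodAt-resp (λ x → ≡.sym (finToFun-funToFin κ x)) g
        go : (h : Dec (∃ λ y → p (ψ y) ≡ t)) (w : Dec (Witness-of t)) →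
          not (does h) ∧ does w ≡ true → ∃ λ (y : Fin Y) → GoodAt t (finToFun y)
        go (no unhit) (yes (v , (χv , refl) , bad≡0 , low)) _ = coded (goodAt v χv bad≡0 low (λ y eq → unhit (y , eq)))

      hit : Fin ℓ → ℕ
      hit t = 𝟙 (does (hit? t))

      exceptional : Fin ℓ → Fin (2 ^ ℓ) → ℕ
      exceptional t z = 𝟙 (good t) + hit t + bad t z

      κ₀ Q : ℕ
      κ₀ = 3 + 4 * m
      Q = Ω * N

      -- A vertex of cost below the threshold whose label is not hit and whose pair is not bad is a
      -- witness, which makes its label good.
      pointwise : ∀ v → χ v ≡ true → κ₀ * Q ≤ 8 * suc m * cost v + κ₀ * Q * exceptional (p v) (q v)
      pointwise v χv = go (hit? (p v)) (witness? (p v)) refl refl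
        where
        absorb : 1 ≤ exceptional (p v) (q v) → κ₀ * Q ≤ 8 * suc m * cost v + κ₀ * Q * exceptional (p v) (q v)
        absorb 1≤ = ≤-trans (≤-trans (≤-reflexive (≡.sym (*-identityʳ (κ₀ * Q)))) (*-monoʳ-≤ (κ₀ * Q) 1≤)) (m≤n+m _ (8 * suc m * cost v))
        go : ∀ h w → h ≡ hit? (p v) → w ≡ witness? (p v) → κ₀ * Q ≤ 8 * suc m * cost v + κ₀ * Q * exceptional (p v) (q v)
        go (yes y) _ eq _ = absorb (≤-trans (≤-reflexive (cong (𝟙 ∘ does) eq)) (≤-trans (m≤n+m (hit (p v)) (𝟙 (good (p v)))) (m≤m+n _ (bad (p v) (q v)))))
        go (no _) (yes w) eq eq′ = absorb (≤-trans (≤-reflexive (cong₂ (λ h w → 𝟙 (not (does h) ∧ does w)) eq eq′)) (≤-trans (m≤m+n (𝟙 (good (p v))) (hit (p v))) (m≤m+n _ (bad (p v) (q v)))))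
        go (no _) (no ∄w) _ _ with bad (p v) (q v) ℕ.≟ 0
        ... | no  bad≢0 = absorb (≤-trans (n≢0⇒n>0 bad≢0) (m≤n+m _ (𝟙 (good (p v)) + hit (p v))))
        ... | yes bad≡0 = ≤-trans (≮⇒≥ λ low → ∄w (v , (χv , refl) , bad≡0 , low)) (m≤m+n _ _)

      -- Double counting: the errors are counted at the embedded vertices, each of small error
      -- degree into `χ`, and the weights of the at most `k` parts add up to at most `k * Ω`.
      totalCost : 8 * suc m * sum (λ v → 𝟙 (χ v) * cost v) ≤ Q * ((2 + 4 * m) * a)
      totalCost = *-cancelˡ-≤ k {{>-nonZero 1≤k}} (begin
        k * (8 * suc m * C)                            ≡⟨ solve 3 (λ k m c → k :* (con 8 :* (con 1 :+ m) :* c) := con 2 :* (con 4 :* k :* (con 1 :+ m) :* c)) refl k m C ⟩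
        2 * (4 * k * suc m * C)                        ≡⟨ cong (λ s → 2 * (4 * k * suc m * s)) exchange ⟩
        2 * (4 * k * suc m * sum (λ j → weight j * sum (λ c → deg (U j c))))
          ≡⟨ cong (2 *_) (trans (sum-*ˡ E _) (sum-cong (λ j → trans (solve 3 (λ e w s → e :* (w :* s) := w :* (e :* s)) refl E (weight j) (sum (λ c → deg (U j c)))) (cong (weight j *_) (sum-*ˡ E _))))) ⟩
        2 * sum (λ j → weight j * sum (λ c → E * deg (U j c)))
          ≤⟨ *-monoʳ-≤ 2 (sum-mono (λ j → *-monoʳ-≤ (weight j) (sum-mono (λ c → sparse (U j c) (inside (combine j c)))))) ⟩
        2 * sum (λ j → weight j * sum {N} (λ c → suc (2 * m) * a))
          ≡⟨ cong (2 *_) (trans (sum-cong (λ j → trans (cong (weight j *_) (sum-const N _)) (*-comm (weight j) _))) (≡.sym (sum-*ˡ (N * (suc (2 * m) * a)) weight))) ⟩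
        2 * (N * (suc (2 * m) * a) * sum weight)
          ≤⟨ *-monoʳ-≤ 2 (*-monoʳ-≤ (N * (suc (2 * m) * a)) (≤-trans total (*-monoˡ-≤ Ω r≤k))) ⟩
        2 * (N * (suc (2 * m) * a) * (k * Ω))
          ≡⟨ solve 5 (λ n m a k o → con 2 :* (n :* ((con 1 :+ con 2 :* m) :* a) :* (k :* o)) := k :* (o :* n :* ((con 2 :+ con 4 :* m) :* a))) refl N m a k Ω ⟩
        k * (Q * ((2 + 4 * m) * a)) ∎)
        where
        open ≤-Reasoning
        C E : ℕ
        C = sum (λ v → 𝟙 (χ v) * cost v)
        E = 4 * k * suc m
        deg : Fin n → ℕ
        deg u = sum (λ v → 𝟙 (χ v) * 𝟙 (D v u))
        exchange : C ≡ sum (λ j → weight j * sum (λ c → deg (U j c)))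
        exchange = trans (sum-cong (λ v → trans (sum-*ˡ (𝟙 (χ v)) _) (sum-cong (λ j →
            trans (solve 3 (λ x w s → x :* (w :* s) := w :* (x :* s)) refl (𝟙 (χ v)) (weight j) (sum (λ c → 𝟙 (D v (U j c)))))
              (cong (weight j *_) (sum-*ˡ (𝟙 (χ v)) _))))))
          (trans (sum-comm _) (sum-cong (λ j → trans (≡.sym (sum-*ˡ (weight j) _)) (cong (weight j *_) (sum-comm _)))))

      #good : ℕ
      #good = sum (λ t → 𝟙 (good t))

      hit-few : sum hit ≤ L
      hit-few = begin
        sum hit                                                     ≤⟨ sum-mono (λ t → one t (hit? t)) ⟩
        sum (λ t → sum (λ y → 𝟙 (does (t ≟ p (ψ y)))))              ≡⟨ sum-comm _ ⟩
        sum (λ y → sum (λ t → 𝟙 (does (t ≟ p (ψ y)))))              ≡⟨ sum-cong (λ y → trans (sum-cong (λ t → ≡.sym (*-identityʳ _))) (sum-δ (p (ψ y)) (λ _ → 1))) ⟩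
        sum {L} (λ y → 1)                                           ≡⟨ trans (sum-const L 1) (*-identityʳ L) ⟩
        L                                                           ∎
        where
        open ≤-Reasoning
        one : ∀ t (h : Dec (∃ λ y → p (ψ y) ≡ t)) → 𝟙 (does h) ≤ sum (λ y → 𝟙 (does (t ≟ p (ψ y))))
        one t (yes (y , eq)) = ≤-trans (≤-reflexive (≡.sym (cong 𝟙 (dec-true (t ≟ p (ψ y)) (≡.sym eq))))) (term≤sum (λ y → 𝟙 (does (t ≟ p (ψ y)))) y)
        one t (no _)         = z≤n

      W : ℕ
      W = sum (λ t → sum (λ z → exceptional t z))

      W-bound : 32 * suc m * suc m * W ≤ 32 * suc m * suc m * (#good + L) * 2 ^ ℓ + ℓ * 2 ^ ℓ
      W-bound = begin
        M * W
          ≡⟨ cong (M *_) (trans (sum-cong (λ t → trans (sum-+ _ _) (cong (_+ sum (bad t)) (sum-const (2 ^ ℓ) _)))) (sum-+ _ _)) ⟩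
        M * (sum (λ t → 2 ^ ℓ * (𝟙 (good t) + hit t)) + sum (λ t → sum (bad t)))
          ≡⟨ cong (λ s → M * (s + sum (λ t → sum (bad t)))) (trans (≡.sym (sum-*ˡ (2 ^ ℓ) _)) (cong (2 ^ ℓ *_) (sum-+ _ _))) ⟩
        M * (2 ^ ℓ * (#good + sum hit) + sum (λ t → sum (bad t)))
          ≡⟨ trans (*-distribˡ-+ M (2 ^ ℓ * (#good + sum hit)) _) (cong₂ _+_ (solve 3 (λ m l s → m :* (l :* s) := m :* s :* l) refl M (2 ^ ℓ) (#good + sum hit)) (sum-*ˡ M _)) ⟩
        M * (#good + sum hit) * 2 ^ ℓ + sum (λ t → M * sum (bad t))
          ≤⟨ +-mono-≤ (*-monoˡ-≤ (2 ^ ℓ) (*-monoʳ-≤ M (+-monoʳ-≤ #good hit-few))) (≤-trans (sum-mono bad-few) (≤-reflexive (sum-const ℓ (2 ^ ℓ)))) ⟩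
        M * (#good + L) * 2 ^ ℓ + ℓ * 2 ^ ℓ ∎
        where
        open ≤-Reasoning
        M = 32 * suc m * suc m

      -- Markov's inequality: after scaling by `8 * suc m`, the threshold exceeds the average bound
      -- by `Q` per vertex of `χ`. The exceptional pairs, each carried by at most `c` vertices, must
      -- pay for this excess.
      a-bound : a ≤ κ₀ * (c * W)
      a-bound = *-cancelˡ-≤ Q {{>-nonZero (*-mono-≤ 1≤Ω 1≤N)}} (+-cancelˡ-≤ (Q * ((2 + 4 * m) * a)) _ _ (begin
        Q * ((2 + 4 * m) * a) + Q * a            ≡⟨ solve 3 (λ q m a → q :* ((con 2 :+ con 4 :* m) :* a) :+ q :* a := (con 3 :+ con 4 :* m) :* q :* a) refl Q m a ⟩
        κ₀ * Q * a                               ≡⟨ sum-*ˡ (κ₀ * Q) _ ⟩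
        sum (λ v → κ₀ * Q * 𝟙 (χ v))             ≤⟨ sum-mono weighted ⟩
        sum (λ v → 8 * suc m * (𝟙 (χ v) * cost v) + κ₀ * Q * exceptional (p v) (q v))
          ≡⟨ trans (sum-+ _ _) (cong₂ _+_ (≡.sym (sum-*ˡ (8 * suc m) _)) (≡.sym (sum-*ˡ (κ₀ * Q) _))) ⟩
        8 * suc m * sum (λ v → 𝟙 (χ v) * cost v) + κ₀ * Q * sum (λ v → exceptional (p v) (q v))
          ≤⟨ +-mono-≤ totalCost (*-monoʳ-≤ (κ₀ * Q) (balance exceptional)) ⟩
        Q * ((2 + 4 * m) * a) + κ₀ * Q * (c * W)
          ≡⟨ cong (Q * ((2 + 4 * m) * a) +_) (solve 3 (λ k q w → k :* q :* w := q :* (k :* w)) refl κ₀ Q (c * W)) ⟩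
        Q * ((2 + 4 * m) * a) + Q * (κ₀ * (c * W)) ∎))
        where
        open ≤-Reasoning
        weighted : ∀ v → κ₀ * Q * 𝟙 (χ v) ≤ 8 * suc m * (𝟙 (χ v) * cost v) + κ₀ * Q * exceptional (p v) (q v)
        weighted v = go (χ v) refl
          where
          go : ∀ b → χ v ≡ b → κ₀ * Q * 𝟙 b ≤ 8 * suc m * (𝟙 b * cost v) + κ₀ * Q * exceptional (p v) (q v)
          go true χv = subst₂ _≤_ (≡.sym (*-identityʳ (κ₀ * Q)))
            (cong (λ s → 8 * suc m * s + κ₀ * Q * exceptional (p v) (q v)) (≡.sym (*-identityˡ (cost v)))) (pointwise v χv)
          go false _ = ≤-trans (≤-reflexive (*-zeroʳ (κ₀ * Q))) z≤n

      -- Of a total of `2 * (ℓ * 2 ^ ℓ)`, the bad pairs supply at most half; the rest must come from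
      -- good labels and the at most `L` hit ones.
      ℓ-bound : ℓ ≤ 32 * suc m * suc m * (#good + L)
      ℓ-bound = *-cancelʳ-≤ _ _ (2 ^ ℓ) {{m^n≢0 2 ℓ}} (+-cancelʳ-≤ (ℓ * 2 ^ ℓ) _ _ (begin
        ℓ * 2 ^ ℓ + ℓ * 2 ^ ℓ            ≡⟨ cong (ℓ * 2 ^ ℓ +_) (+-identityʳ (ℓ * 2 ^ ℓ)) ⟨
        2 * (ℓ * 2 ^ ℓ)                  ≤⟨ *-monoʳ-≤ 2 doubled ⟩
        -- Rounds the factor `8 (m + 1) (4m + 3)` up to `32 (m + 1)^2`.
        2 * (4 * suc m * (κ₀ * W))       ≤⟨ m≤m+n _ (8 * suc m * W) ⟩
        2 * (4 * suc m * (κ₀ * W)) + 8 * suc m * W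
          ≡⟨ solve 2 (λ m w → con 2 :* (con 4 :* (con 1 :+ m) :* ((con 3 :+ con 4 :* m) :* w)) :+ con 8 :* (con 1 :+ m) :* w := con 32 :* (con 1 :+ m) :* (con 1 :+ m) :* w) refl m W ⟩
        32 * suc m * suc m * W           ≤⟨ W-bound ⟩
        32 * suc m * suc m * (#good + L) * 2 ^ ℓ + ℓ * 2 ^ ℓ ∎))
        where
        open ≤-Reasoning
        doubled : ℓ * 2 ^ ℓ ≤ 4 * suc m * (κ₀ * W)
        doubled = *-cancelˡ-≤ c {{>-nonZero 1≤c}} (≤-trans large (≤-trans (*-monoʳ-≤ (4 * suc m) a-bound)
          (≤-reflexive (solve 4 (λ m k c w → m :* (k :* (c :* w)) := c :* (m :* (k :* w))) refl (4 * suc m) κ₀ c W))))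

      many : Y * suc R < #good
      many = ≰⇒> λ few → <⇒≱ ℓ-large (≤-trans ℓ-bound (*-monoʳ-≤ (32 * suc m * suc m) (+-monoˡ-≤ L few)))

      -- One label more than `R`: the properties of `κ` are read off the first, which exists even
      -- for `R = 0`.
      common : ∃ λ y → Σ (Fin (suc R) → Fin ℓ) λ τ → (∀ {i j} → τ i ≡ τ j → i ≡ j) × (∀ i → GoodAt (τ i) (finToFun y))
      common = popular-colour {P = λ t y → GoodAt t (finToFun y)} (suc R) good goodAt-of many

      κ : Fin T → Fin L
      κ = finToFun (proj₁ common)

    attachable : Attachable S r F R
    attachable = record
      { embedding = record
        { ψ       = λ x → ψ (κ x)
        ; inside  = λ x → inside (κ x)
        ; labels  = λ x y ltx lty eq → injective x y ltx lty (labels (κ x) (κ y) (below x ltx) (below y lty) eq)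
        ; linked  = λ x y ltx lty → trans (linked (κ x) (κ y) (below x ltx)
            (subst₂ _<_ (≡.sym (samePart y (<-trans lty ltx))) (≡.sym (samePart x ltx)) lty)) (links x y ltx lty)
        ; colour  = colour
        ; uniform = λ x y ltx eq ne → trans (uniform (κ x) (κ y) (below x ltx)
            (trans (samePart x ltx) (trans eq (≡.sym (samePart y (subst (_< r) eq ltx)))))
            (λ same → ne (injective x y ltx (subst (_< r) eq ltx) same))) (cong colour (samePart x ltx))
        }
      ; τ      = proj₁ (proj₂ common) ∘ suc
      ; τ-inj  = λ eq → suc-injective (proj₁ (proj₂ (proj₂ common)) eq)
      ; fresh  = λ i x → GoodAt.unhit (proj₂ (proj₂ (proj₂ common)) (suc i)) (κ x)
      ; attach = λ i → GoodAt.realise (proj₂ (proj₂ (proj₂ common)) (suc i))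
      }
      where
      open GoodAt (proj₂ (proj₂ (proj₂ common)) zero)
      below : ∀ x → part F x < r → part (blowUp host N) (κ x) < r
      below x lt = subst (_< r) (≡.sym (samePart x lt)) lt

-- Induction on the number of embedded parts

Embeds : ℕ → ℕ → ℕ → Pattern → Set
Embeds k m r F = ∃ λ ℓ₀ → ∀ ℓ → ℓ₀ ≤ ℓ → ∀ {n} {G : Graph n} (S : Setting k m ℓ G) → Embedding S r F

-- The order of the choices matters: first the dense host for `F`, then the number of clones, then
-- the bound on `ℓ`, all before the graph is given.
attachable-eventually : ∀ {k m r} → 1 ≤ k → r ≤ k → (∀ F → Embeds k m r F) →
  ∀ F R → ∃ λ ℓ₀ → ∀ ℓ → ℓ₀ ≤ ℓ → ∀ {n} {G : Graph n} (S : Setting k m ℓ G) → Attachable S r F R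
attachable-eventually {k} {m} {r} 1≤k r≤k embeds F R =
  proj₁ old ⊔ suc bound , λ ℓ le S → Attach.attachable 1≤k r≤k F R H N₁ 1≤N₁ ball
    (≤-trans (m≤n⊔m (proj₁ old) (suc bound)) le) S (proj₂ old ℓ (≤-trans (m≤m⊔n (proj₁ old) (suc bound)) le) S)
  where
  H : DenseHost r (8 * suc m) F
  H = dense-host r (8 * suc m) F (s≤s z≤n)

  c₀ T̂ C : ℕ
  c₀ = 7 + 8 * m
  T̂ = size (DenseHost.host H)
  C = 32 * suc m * suc m * (suc T̂ * 2 ^ T̂)

  chosen : _
  chosen = ball-small c₀ C (T̂ * T̂)

  N₁ : ℕ
  N₁ = proj₁ chosen

  1≤N₁ : 1 ≤ N₁
  1≤N₁ = proj₁ (proj₂ chosen)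

  N L bound : ℕ
  N = 2 * suc c₀ * N₁
  L = T̂ * N
  bound = 32 * suc m * suc m * (L ^ size F * suc R + L)

  old : Embeds k m r (blowUp (DenseHost.host H) N)
  old = embeds (blowUp (DenseHost.host H) N)

  ball : 32 * suc m * suc m * (suc T̂ * (2 ^ T̂ * matchingBound N T̂)) * (suc c₀ + suc (suc c₀)) ^ N ≤
    suc c₀ ^ (c₀ * N₁) * suc (suc c₀) ^ (suc (suc c₀) * N₁) * 2 ^ N
  ball = ≤-trans (*-monoˡ-≤ ((suc c₀ + suc (suc c₀)) ^ N) (≤-trans
      (≤-reflexive (solve 4 (λ m t p b → m :* (t :* (p :* b)) := m :* (t :* p) :* b) refl (32 * suc m * suc m) (suc T̂) (2 ^ T̂) (matchingBound N T̂)))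
      (*-monoʳ-≤ C (matchingBound-poly N T̂)))) (proj₂ (proj₂ chosen))

-- A copy of F for every choice Q of size F among R new classes, to be attached as if a part of F were placed at Q.
ramseyCopies : Pattern → Pattern
ramseyCopies F = record
  { size = R ^ T * T
  ; part = λ w → part F (remainder {R ^ T} T w)
  ; link = λ w w′ → link F (remainder {R ^ T} T w) (remainder {R ^ T} T w′) }
  where
  T R : ℕ
  T = size F
  R = 2 ^ (T + T)

module Extend {k m ℓ r n : ℕ} {G : Graph n} (F : Pattern) (S : Setting k m ℓ G)
  (att : Attachable S r (ramseyCopies F) (2 ^ (size F + size F))) where

  open Setting S
  open Attachable att
  private
    T R : ℕ
    T = size F
    R = 2 ^ (T + T)

    -- In the copy belonging to a choice of classes, the new vertex of class `ρ` is attached like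
    -- the vertex `x` of `F` that this choice places at `ρ`.
    row : Fin R → Fin (R ^ T * T) → Bool
    row ρ w with any? (λ x → finToFun {R} {T} (quotient T w) x ≟ ρ)
    ... | yes (x , _) = link F x (remainder {R ^ T} T w)
    ... | no _        = false

    new : ∀ ρ → ∃ λ w → χ w ≡ true × p w ≡ τ ρ × (∀ x → part (ramseyCopies F) x < r → adj G w (ψ x) ≡ row ρ x)
    new ρ = attach ρ (row ρ)

    w : Fin R → Fin n
    w ρ = proj₁ (new ρ)

    K : Fin R → Fin R → Bool
    K ρ ρ′ = adj G (w ρ) (w ρ′)

    homogeneous : ∃ λ b → Σ (Fin T → Fin R) λ Q → ∀ i j → i ≢ j → Q i ≢ Q j × K (Q i) (Q j) ≡ b
    homogeneous with ramsey K (λ ρ ρ′ → sym G (w ρ) (w ρ′)) T T (allFin R) (Unique.allFin⁺ R) (≤-reflexive (≡.sym (length-tabulate id)))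
    ... | inj₁ (Q , _ , hom) = true , Q , hom
    ... | inj₂ (Q , _ , hom) = false , Q , hom

    b : Bool
    b = proj₁ homogeneous

    Q : Fin T → Fin R
    Q = proj₁ (proj₂ homogeneous)

    Q-inj : ∀ x y → Q x ≡ Q y → x ≡ y
    Q-inj x y eq with x ≟ y
    ... | yes x≡y = x≡y
    ... | no  x≢y = contradiction eq (proj₁ (proj₂ (proj₂ homogeneous) x y x≢y))

    -- The copy used is the one belonging to the homogeneous choice `Q`, which is known only after
    -- all classes have been attached.
    at : Fin T → Fin (R ^ T * T)
    at x = combine (funToFin Q) x

    remainder-at : ∀ x → remainder {R ^ T} T (at x) ≡ x
    remainder-at x = cong proj₂ (remQuot-combine (funToFin Q) x)

    quotient-at : ∀ x → quotient {R ^ T} T (at x) ≡ funToFin Q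
    quotient-at x = cong proj₁ (remQuot-combine (funToFin Q) x)

    part-at : ∀ x → part (ramseyCopies F) (at x) ≡ part F x
    part-at x = cong (part F) (remainder-at x)

    row-at : ∀ x y → row (Q x) (at y) ≡ link F x y
    row-at x y with any? (λ x′ → finToFun {R} {T} (quotient T (at y)) x′ ≟ Q x)
    ... | yes (x′ , eq) = cong₂ (link F) (Q-inj x′ x (trans (≡.sym (trans (cong (λ z → finToFun z x′) (quotient-at y)) (finToFun-funToFin Q x′))) eq)) (remainder-at y)
    ... | no ∄ = contradiction (x , trans (cong (λ z → finToFun z x) (quotient-at y)) (finToFun-funToFin Q x)) ∄

    below-at : ∀ x → part F x < r → part (ramseyCopies F) (at x) < r
    below-at x = subst (_< r) (≡.sym (part-at x))

    image : ∀ x → Dec (part F x < r) → Fin n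
    image x (yes _) = ψ (at x)
    image x (no _)  = w (Q x)

    hue : ∀ i → Dec (i < r) → Bool
    hue i (yes _) = colour i
    hue i (no _)  = b

    inside′ : ∀ x d → χ (image x d) ≡ true
    inside′ x (yes _) = inside (at x)
    inside′ x (no _)  = proj₁ (proj₂ (new (Q x)))

    labels′ : ∀ x y d d′ → p (image x d) ≡ p (image y d′) → x ≡ y
    labels′ x y (yes lt) (yes lt′) eq =
      proj₂ (combine-injective (funToFin Q) x (funToFin Q) y (labels (at x) (at y) (below-at x lt) (below-at y lt′) eq))
    labels′ x y (yes _) (no _) eq = contradiction (trans eq (proj₁ (proj₂ (proj₂ (new (Q y)))))) (fresh (Q y) (at x))
    labels′ x y (no _) (yes _) eq = contradiction (trans (≡.sym eq) (proj₁ (proj₂ (proj₂ (new (Q x)))))) (fresh (Q x) (at y))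
    labels′ x y (no _) (no _) eq = Q-inj x y (τ-inj (trans (≡.sym (proj₁ (proj₂ (proj₂ (new (Q x)))))) (trans eq (proj₁ (proj₂ (proj₂ (new (Q y))))))))

    linked′ : ∀ x y → part F x < suc r → part F y < part F x → ∀ d d′ → adj G (image x d) (image y d′) ≡ link F x y
    linked′ x y ltx lty (yes lt) (yes _) = trans (linked (at x) (at y) (below-at x lt) (subst₂ _<_ (≡.sym (part-at y)) (≡.sym (part-at x)) lty))
      (cong₂ (link F) (remainder-at x) (remainder-at y))
    linked′ x y ltx lty (no _) (yes lt) = trans (proj₂ (proj₂ (proj₂ (new (Q x)))) (at y) (below-at y lt)) (row-at x y)
    linked′ x y ltx lty _ (no ≮r) = contradiction (<-≤-trans lty (≤-pred ltx)) ≮r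

    uniform′ : ∀ x y → part F x ≡ part F y → x ≢ y → ∀ d d′ d″ → adj G (image x d) (image y d′) ≡ hue (part F x) d″
    uniform′ x y eq ne (yes lt) (yes _) (yes _) = trans (uniform (at x) (at y) (below-at x lt) (trans (part-at x) (trans eq (≡.sym (part-at y))))
      (λ same → ne (proj₂ (combine-injective (funToFin Q) x (funToFin Q) y same)))) (cong colour (part-at x))
    uniform′ x y eq ne (no _) (no _) (no _) = proj₂ (proj₂ (proj₂ homogeneous) x y ne)
    uniform′ x y eq ne (yes lt) (no ≮r) _ = contradiction (subst (_< r) eq lt) ≮r
    uniform′ x y eq ne (no ≮r) (yes lt) _ = contradiction (subst (_< r) (≡.sym eq) lt) ≮r
    uniform′ x y eq ne (yes lt) (yes _) (no ≮r) = contradiction lt ≮r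
    uniform′ x y eq ne (no ≮r) (no _) (yes lt) = contradiction lt ≮r

  extended : Embedding S (suc r) F
  extended = record
    { ψ       = λ x → image x (part F x <? r)
    ; inside  = λ x → inside′ x (part F x <? r)
    ; labels  = λ x y _ _ → labels′ x y (part F x <? r) (part F y <? r)
    ; linked  = λ x y ltx lty → linked′ x y ltx lty (part F x <? r) (part F y <? r)
    ; colour  = λ i → hue i (i <? r)
    ; uniform = λ x y _ eq ne → uniform′ x y eq ne (part F x <? r) (part F y <? r) (part F x <? r)
    }

-- Attaching a new part requires at most `k` parts to be present, so the induction reaches `k + 1`
-- parts.
embeds : ∀ {k m} → 1 ≤ k → ∀ r → r ≤ suc k → ∀ F → Embeds k m r F
-- No part is constrained yet, so all of `F` is sent to one vertex of `χ`.
embeds {k} {m} 1≤k zero _ F = 1 , λ ℓ 1≤ℓ {n} S → let open Setting S in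
  let v , χv = large-term 0 (λ v → 𝟙 (χ v)) (subst (_< a) (≡.sym (*-zeroʳ n)) (nonempty ℓ 1≤ℓ S)) in record
    { ψ = λ _ → v ; inside = λ _ → true-of χv ; labels = λ x y () ; linked = λ x y () ; colour = λ _ → true ; uniform = λ x y () }
  where
  true-of : ∀ {b} → 0 < 𝟙 b → b ≡ true
  true-of {true} _ = refl
  nonempty : ∀ ℓ → 1 ≤ ℓ → ∀ {n} {G : Graph n} (S : Setting k m ℓ G) → 0 < Setting.a S
  nonempty ℓ 1≤ℓ S = n≢0⇒n>0 λ a≡0 → <⇒≱ (*-mono-≤ 1≤c (*-mono-≤ 1≤ℓ (m^n>0 2 ℓ)))
    (≤-trans large (≤-reflexive (trans (cong (4 * suc m *_) a≡0) (*-zeroʳ (4 * suc m)))))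
    where open Setting S
embeds {k} {m} 1≤k (suc r) r<k F = proj₁ step , λ ℓ le S → Extend.extended F S (proj₂ step ℓ le S)
  where
  step : ∃ λ ℓ₀ → ∀ ℓ → ℓ₀ ≤ ℓ → ∀ {n} {G : Graph n} (S : Setting k m ℓ G) → Attachable S r (ramseyCopies F) (2 ^ (size F + size F))
  step = attachable-eventually 1≤k (≤-pred r<k) (embeds 1≤k r (<⇒≤ r<k)) (ramseyCopies F) _

-- The host graph, and H as a multipartite pattern

module _ {h : ℕ} (H : Graph h) (k : ℕ) (bc : BinaryColourable H (suc k)) where

  private
    -- `col` declares each part a clique (`true`) or a coclique (`false`). The pieces of a partition
    -- of `H` with that number of cliques are placed on parts of their own type.
    module Partitioned (col : Fin (suc k) → Bool) where
      cliques cocliques : ℕ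
      cliques = sum (λ i → 𝟙 (col i))
      cocliques = suc k ∸ cliques

      cocliques≡ : sum (λ i → 𝟙 (not (col i))) ≡ cocliques
      cocliques≡ = ≡.sym (trans (cong (_∸ cliques) (≡.sym (count-split col))) (m+n∸m≡n cliques _))

      partition : CliqueCocliquePartition H cliques cocliques
      partition = bc cliques (≤-trans (m≤m+n cliques _) (≤-reflexive (count-split col)))

      trues = count-extract cliques col ≤-refl
      falses = count-extract cocliques (not ∘ col) (≤-reflexive (≡.sym cocliques≡))

      place : Fin cliques ⊎ Fin cocliques → Fin (suc k)
      place = [ proj₁ trues , proj₁ falses ]′

      partOf : Fin h → Fin (suc k)
      partOf y = place (CliqueCocliquePartition.part partition y)

      not-true : ∀ {b} → not b ≡ true → b ≡ false
      not-true {false} _ = refl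

      same-part : ∀ y y′ → y ≢ y′ → partOf y ≡ partOf y′ → adj H y y′ ≡ col (partOf y)
      same-part y y′ ne = go _ _ refl refl
        where
        open CliqueCocliquePartition partition renaming (part to part₀)
        go : ∀ s s′ → part₀ y ≡ s → part₀ y′ ≡ s′ → place s ≡ place s′ → adj H y y′ ≡ col (place s)
        go (inj₁ i) (inj₁ j) e e′ eq with proj₁ (proj₂ trues) eq
        ... | refl = trans (clique y y′ i e e′ ne) (≡.sym (proj₂ (proj₂ trues) i))
        go (inj₂ i) (inj₂ j) e e′ eq with proj₁ (proj₂ falses) eq
        ... | refl = trans (coclique y y′ i e e′) (≡.sym (not-true (proj₂ (proj₂ falses) i)))
        go (inj₁ i) (inj₂ j) e e′ eq = contradiction (trans (≡.sym (proj₂ (proj₂ trues) i)) (trans (cong col eq) (not-true (proj₂ (proj₂ falses) j)))) λ ()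
        go (inj₂ i) (inj₁ j) e e′ eq = contradiction (trans (≡.sym (proj₂ (proj₂ trues) j)) (trans (cong col (≡.sym eq)) (not-true (proj₂ (proj₂ falses) i)))) λ ()

  -- One copy of H for each way of declaring every part a clique or a coclique.
  inducedPattern : Pattern
  inducedPattern = record
    { size = 2 ^ suc k * h
    ; part = λ w → toℕ (Partitioned.partOf (bit {suc k} (quotient h w)) (remainder {2 ^ suc k} h w))
    ; link = λ w w′ → adj H (remainder {2 ^ suc k} h w) (remainder {2 ^ suc k} h w′) }

  -- `z` selects the copy of `H` whose declared types are those that occurred. Adjacencies between
  -- different parts come from the pattern, those inside a part from its uniform colour.
  contains-induced : ∀ {m ℓ n} {G : Graph n} (S : Setting k m ℓ G) (emb : Embedding S (suc k) inducedPattern) (z : Fin (2 ^ suc k)) →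
    (∀ i → bit {suc k} z i ≡ Embedding.colour emb (toℕ i)) → ContainsInduced G H
  contains-induced {n = n} {G = G} S emb z bit-z = f , f-inj , preserved
    where
    open Setting S
    open Embedding emb
    open Partitioned (bit {suc k} z)

    at : Fin h → Fin (2 ^ suc k * h)
    at y = combine z y

    remainder-at : ∀ y → remainder {2 ^ suc k} h (at y) ≡ y
    remainder-at y = cong proj₂ (remQuot-combine z y)

    part-at : ∀ y → part inducedPattern (at y) ≡ toℕ (partOf y)
    part-at y = cong (λ zy → toℕ (Partitioned.partOf (bit {suc k} (proj₁ zy)) (proj₂ zy))) (remQuot-combine z y)

    below : ∀ y → part inducedPattern (at y) < suc k
    below y = subst (_< suc k) (≡.sym (part-at y)) (toℕ<n (partOf y))

    f : Fin h → Fin n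
    f y = ψ (at y)

    f-inj : ∀ {y y′} → f y ≡ f y′ → y ≡ y′
    f-inj {y} {y′} eq = proj₂ (combine-injective z y z y′ (labels (at y) (at y′) (below y) (below y′) (cong p eq)))

    downward : ∀ y y′ → toℕ (partOf y′) < toℕ (partOf y) → adj H y y′ ≡ adj G (f y) (f y′)
    downward y y′ lt = ≡.sym (trans (linked (at y) (at y′) (below y) (subst₂ _<_ (≡.sym (part-at y′)) (≡.sym (part-at y)) lt))
      (cong₂ (adj H) (remainder-at y) (remainder-at y′)))

    level : ∀ y y′ → y ≢ y′ → toℕ (partOf y) ≡ toℕ (partOf y′) → adj H y y′ ≡ adj G (f y) (f y′)
    level y y′ y≢y′ eq = begin
      adj H y y′                              ≡⟨ same-part y y′ y≢y′ (toℕ-injective eq) ⟩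
      bit {suc k} z (partOf y)                ≡⟨ bit-z (partOf y) ⟩
      colour (toℕ (partOf y))                 ≡⟨ cong colour (part-at y) ⟨
      colour (part inducedPattern (at y))     ≡⟨ uniform (at y) (at y′) (below y) (trans (part-at y) (trans eq (≡.sym (part-at y′))))
                                                   (λ same → y≢y′ (proj₂ (combine-injective z y z y′ same))) ⟨
      adj G (f y) (f y′)                      ∎
      where open ≡-Reasoning

    preserved : ∀ y y′ → adj H y y′ ≡ adj G (f y) (f y′)
    preserved y y′ = go (y ≟ y′) (<-cmp (toℕ (partOf y)) (toℕ (partOf y′)))
      where
      go : Dec (y ≡ y′) → Tri (toℕ (partOf y) < toℕ (partOf y′)) (toℕ (partOf y) ≡ toℕ (partOf y′)) (toℕ (partOf y) > toℕ (partOf y′)) →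
        adj H y y′ ≡ adj G (f y) (f y′)
      go (yes refl) _ = trans (irrefl H y) (≡.sym (irrefl G (f y)))
      go (no _) (tri< lt _ _) = trans (sym H y y′) (trans (downward y′ y lt) (sym G (f y′) (f y)))
      go (no _) (tri> _ _ gt) = downward y y′ gt
      go (no y≢y′) (tri≈ _ eq _) = level y y′ y≢y′ eq

-- Edit distance, the blown-up host graph and the lower bound

contains-relabel : ∀ {n h} (σ : Permutation′ n) (G : Graph n) (H : Graph h) → ContainsInduced (relabel σ G) H → ContainsInduced G H
contains-relabel σ G H (f , inj , ok) =
  (λ i → σ ⟨$⟩ʳ f i) , (λ eq → inj (trans (≡.sym (inverseˡ σ)) (trans (cong (σ ⟨$⟩ˡ_) eq) (inverseˡ σ)))) , ok

listSum : ∀ n {A : Set} (g : Fin n → A) (f : A → ℕ) → ListAction.sum (map f (tabulate g)) ≡ sum (f ∘ g)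
listSum zero    g f = ≡.sym (sum-empty (f ∘ g))
listSum (suc n) g f = trans (cong (f (g zero) +_) (listSum n (g ∘ suc) f)) (≡.sym (sum-suc (f ∘ g)))

symDiff-sum : ∀ {n} (G G′ : Graph n) →
  symDiff G G′ ≡ sum (λ i → sum (λ j → 𝟙 ((toℕ i <ᵇ toℕ j) ∧ (adj G i j xor adj G′ i j))))
symDiff-sum {n} G G′ = trans (listSum n id _) (sum-cong (λ i → listSum n id _))

xor-sym : ∀ {n} (G G′ : Graph n) i j → adj G i j xor adj G′ i j ≡ adj G j i xor adj G′ j i
xor-sym G G′ i j = cong₂ _xor_ (sym G i j) (sym G′ i j)

xor-irrefl : ∀ {n} (G G′ : Graph n) i → adj G i i xor adj G′ i i ≡ false
xor-irrefl G G′ i = cong₂ _xor_ (irrefl G i) (irrefl G′ i)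

ordered-pairs : ∀ {n} (G G′ : Graph n) → sum (λ i → sum (λ j → 𝟙 (adj G j i xor adj G′ j i))) ≤ 2 * symDiff G G′
ordered-pairs {n} G G′ = begin
  sum (λ i → sum (λ j → 𝟙 (d j i)))                        ≤⟨ sum-mono (λ i → sum-mono (pair i)) ⟩
  sum (λ i → sum (λ j → below i j + below j i))            ≡⟨ trans (sum-cong (λ i → sum-+ _ _)) (sum-+ _ _) ⟩
  total + sum (λ i → sum (λ j → below j i))                ≡⟨ cong (total +_) (sum-comm (λ i j → below j i)) ⟩
  total + total                                            ≡⟨ cong (total +_) (+-identityʳ total) ⟨
  2 * total                                                ≡⟨ cong (2 *_) (symDiff-sum G G′) ⟨
  2 * symDiff G G′                                         ∎
  where
  open ≤-Reasoning
  d : Fin n → Fin n → Bool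
  d i j = adj G i j xor adj G′ i j
  below : Fin n → Fin n → ℕ
  below i j = 𝟙 ((toℕ i <ᵇ toℕ j) ∧ d i j)
  total = sum (λ i → sum (λ j → below i j))
  ordered : ∀ {i j} → toℕ i < toℕ j → 𝟙 (d i j) ≤ below i j
  ordered {i} {j} lt with toℕ i <ᵇ toℕ j | <⇒<ᵇ lt
  ... | true | _ = ≤-refl
  pair : ∀ i j → 𝟙 (d j i) ≤ below i j + below j i
  pair i j with <-cmp (toℕ i) (toℕ j)
  ... | tri< lt _ _ = ≤-trans (≤-reflexive (cong 𝟙 (xor-sym G G′ j i))) (≤-trans (ordered lt) (m≤m+n _ (below j i)))
  ... | tri> _ _ gt = ≤-trans (ordered gt) (m≤n+m _ (below i j))
  ... | tri≈ _ eq _ = ≤-trans (≤-reflexive (trans (cong (λ t → 𝟙 (d j t)) (toℕ-injective eq)) (cong 𝟙 (xor-irrefl G G′ j)))) z≤n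

module HostGraph (ℓ₀ n : ℕ) where

  ℓ s c : ℕ
  ℓ = suc ℓ₀
  s = ℓ * 2 ^ ℓ

  instance
    s-nonZero : NonZero s
    s-nonZero = m*n≢0 ℓ (2 ^ ℓ) {{_}} {{m^n≢0 2 ℓ}}

  c = suc (n / s)

  n≤cs : n ≤ c * s
  n≤cs = ≤-trans (≤-reflexive (m≡m%n+[m/n]*n n s)) (+-monoˡ-≤ (n / s * s) (<⇒≤ (m%n<n n s)))

  cs≤2n : s ≤ n → c * s ≤ 2 * n
  cs≤2n s≤n = ≤-trans (+-mono-≤ s≤n (≤-trans (m≤n+m (n / s * s) (n % s)) (≤-reflexive (≡.sym (m≡m%n+[m/n]*n n s)))))
    (≤-reflexive (cong (n +_) (≡.sym (+-identityʳ n))))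

  -- Labels are dealt out cyclically: the remainder of `v` modulo `s` is split into the two labels,
  -- so each pair occurs at most `c` times.
  label : Fin n → Fin ℓ × Fin (2 ^ ℓ)
  label v = remQuot (2 ^ ℓ) (remainder {c} s (inject≤ v n≤cs))

  balance : ∀ (f : Fin ℓ → Fin (2 ^ ℓ) → ℕ) →
    sum (λ v → f (proj₁ (label v)) (proj₂ (label v))) ≤ c * sum (λ t → sum (λ z → f t z))
  balance f = begin
    sum (λ v → g (remainder {c} s (inject≤ v n≤cs)))      ≤⟨ sum-inject≤ n≤cs (λ w → g (remainder {c} s w)) ⟩
    sum (λ w → g (remainder {c} s w))                     ≡⟨ sum-combine c s _ ⟩
    sum {c} (λ i → sum {s} (λ j → g (remainder {c} s (combine i j)))) ≡⟨ sum-cong (λ i → sum-cong (λ j → cong (g ∘ proj₂) (remQuot-combine i j))) ⟩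
    sum {c} (λ i → sum g)                                 ≡⟨ sum-const c (sum g) ⟩
    c * sum g                                             ≡⟨ cong (c *_) (trans (sum-combine ℓ (2 ^ ℓ) g) (sum-cong (λ t → sum-cong (λ z →
                                                               cong (λ tz → f (proj₁ tz) (proj₂ tz)) (remQuot-combine t z))))) ⟩
    c * sum (λ t → sum (λ z → f t z))                     ∎
    where
    open ≤-Reasoning
    g : Fin s → ℕ
    g y = f (proj₁ (remQuot (2 ^ ℓ) y)) (proj₂ (remQuot (2 ^ ℓ) y))

  G₀ : Graph n
  G₀ = record
    { adj    = λ u v → labelAdj (label u) (label v)
    ; sym    = λ u v → xor-comm (bit {ℓ} (proj₂ (label u)) (proj₁ (label v))) _
    ; irrefl = λ v → xor-same (bit {ℓ} (proj₂ (label v)) (proj₁ (label v))) }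

square-cancel : ∀ {x y} → x * x ≤ y * y → x ≤ y
square-cancel {x} {y} le = ≮⇒≥ λ y<x → <⇒≱ (*-mono-< y<x y<x) le

module _ (k m ℓ₀ n : ℕ) where

  open HostGraph ℓ₀ n

  -- The hypothesis on `symDiff` negates the inequality of the theorem, with `m + 1` for its `m`;
  -- cleaning the error graph then yields `χ`.
  setting : s ≤ n → (G : Graph n) → 4 * k * suc m * symDiff G₀ G ≤ m * (n * n) → Setting k m ℓ G
  setting s≤n G close = record
    { χ = χ ; p = proj₁ ∘ label ; q = proj₂ ∘ label ; c = c ; 1≤c = s≤s z≤n
    ; balance = balance ; large = large ; sparse = proj₂ (proj₂ cleaned) }
    where
    D : Fin n → Fin n → Bool
    D u v = adj G₀ u v xor adj G u v

    open Cleaning D (xor-sym G₀ G) (xor-irrefl G₀ G)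

    A B : ℕ
    A = 4 * k * suc m
    B = suc (2 * m)

    everything : Fin n → Bool
    everything _ = true

    card-everything : card everything ≡ n
    card-everything = trans (sum-const n 1) (*-identityʳ n)

    -- The slack `n * n` survives the cleaning and bounds the remaining set from below; it accounts
    -- for `2m + 1` in place of `2m`.
    initial : Sparse A B (n * n) everything
    initial = begin
      A * edges everything + n * n       ≤⟨ +-monoˡ-≤ (n * n) (*-monoʳ-≤ A (≤-trans (≤-reflexive (sum-cong (λ u → trans (*-identityˡ _) (sum-cong (λ v → *-identityˡ _))))) (ordered-pairs G₀ G))) ⟩
      A * (2 * symDiff G₀ G) + n * n     ≡⟨ cong (_+ n * n) (solve 2 (λ a d → a :* (con 2 :* d) := con 2 :* (a :* d)) refl A (symDiff G₀ G)) ⟩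
      2 * (A * symDiff G₀ G) + n * n     ≤⟨ +-monoˡ-≤ (n * n) (*-monoʳ-≤ 2 close) ⟩
      2 * (m * (n * n)) + n * n          ≡⟨ solve 2 (λ m t → con 2 :* (m :* t) :+ t := (con 1 :+ con 2 :* m) :* t) refl m (n * n) ⟩
      B * (n * n)                        ≡⟨ cong (λ t → B * (t * t)) card-everything ⟨
      B * (card everything * card everything) ∎
      where open ≤-Reasoning

    cleaned : _
    cleaned = clean A B (n * n) everything initial

    χ : Fin n → Bool
    χ = proj₁ cleaned

    n≤ : n ≤ 2 * suc m * card χ
    n≤ = square-cancel (begin
      n * n                                              ≤⟨ m≤n+m (n * n) (A * edges χ) ⟩
      A * edges χ + n * n                                ≤⟨ proj₁ (proj₂ cleaned) ⟩
      B * (card χ * card χ)                              ≤⟨ *-monoˡ-≤ (card χ * card χ) (m≤m+n B (4 * (m * m) + 6 * m + 3)) ⟩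
      (B + (4 * (m * m) + 6 * m + 3)) * (card χ * card χ) ≡⟨ solve 2 (λ m a → (con 1 :+ con 2 :* m :+ (con 4 :* (m :* m) :+ con 6 :* m :+ con 3)) :* (a :* a) := con 2 :* (con 1 :+ m) :* a :* (con 2 :* (con 1 :+ m) :* a)) refl m (card χ) ⟩
      2 * suc m * card χ * (2 * suc m * card χ)          ∎)
      where open ≤-Reasoning

    large : c * (ℓ * 2 ^ ℓ) ≤ 4 * suc m * card χ
    large = ≤-trans (cs≤2n s≤n) (≤-trans (*-monoʳ-≤ 2 n≤) (≤-reflexive
      (solve 2 (λ m a → con 2 :* (con 2 :* (con 1 :+ m) :* a) := con 4 :* (con 1 :+ m) :* a) refl m (card χ))))

-- The term o(1) is expressed by `1 / m` for arbitrary `m`: dividing by `4 * k * m` gives a distance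
-- above `(1 - 1/m) n^2 / (4k)`.
theorem1p2 : ∀ {h : ℕ} (H : Graph h) (k : ℕ) → 1 ≤ k → ChiB≡ H (suc k) →
    ∀ (m : ℕ) → 1 ≤ m →
    Σ ℕ λ N → ∀ n → N ≤ n →
    Σ (Graph n) λ G → ∀ (G' : Graph n) → InForb H G' → ∀ (σ : Permutation′ n) →
    (m ∸ 1) * (n * n) < 4 * k * m * symDiff G (relabel σ G')
-- From `n = s` on, rounding the class size up to `c` at most doubles the total, as `cs≤2n` needs.
-- The value of `s` is the same for every `n`, hence the `0`.
theorem1p2 H k 1≤k χB (suc m) _ = HostGraph.s ℓ₀ 0 , λ n s≤n → HostGraph.G₀ ℓ₀ n , λ G' forb σ → ≰⇒> λ close →
  let emb = proj₂ embeddable (suc ℓ₀) (n≤1+n ℓ₀) (setting k m ℓ₀ n s≤n (relabel σ G') close)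
  in forb (contains-relabel σ G' H
       (contains-induced H k (proj₁ χB) _ emb (code {suc k} (Embedding.colour emb ∘ toℕ)) (bit-code {suc k} _)))
  where
  embeddable : Embeds k m (suc k) (inducedPattern H k (proj₁ χB))
  embeddable = embeds 1≤k (suc k) ≤-refl (inducedPattern H k (proj₁ χB))

  ℓ₀ : ℕ
  ℓ₀ = proj₁ embeddable
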